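{- Let $d\ge2$. For every positive integer $h_1$ there exists a $d$-dimensional integral simplicial convex polytope $\mathcal P\subset\mathbb R^d$ each of whose facets has normalized volume $1$ and such that the $h$-vector of the boundary complex of $\mathcal P$ equals $(1,h_1,h_1,\ldots,h_1,1)\in\mathbb Z^{d+1}$.
   Context: An integral convex polytope is one whose vertices have integer coordinates. For an integral convex polytope $\mathcal Q$ of dimension $e$ in $\mathbb R^N$, its $\delta$-vector $(\delta_0,\ldots,\delta_e)$ is defined by $(1-\lambda)^{e+1}\bigl[1+\sum_{n\ge1}|n\mathcal Q\cap\mathbb Z^N|\lambda^n\bigr]=\sum_{i=0}^e\delta_i\lambda^i$, and its normalized volume is $\sum_i\delta_i$. For a simplicial $d$-polytope with boundary complex having $f_{i}$ faces of dimension $i$ ($f_{ -1}=1$), the $h$-vector $(h_0,\ldots,h_d)$ is defined by $\sum_{i=0}^d h_i x^{d-i}=\sum_{i=0}^{d} f_{i-1}(x-1)^{d-i}$. -}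

module Defs where

open import Data.Nat as ℕ using (ℕ; zero; suc; _∸_; _<_; _≤_)
open import Data.Integer as ℤ using (ℤ; +_; -_)
open import Data.Rational as ℚ using (ℚ; 0ℚ; 1ℚ)
open import Data.Fin using (Fin; toℕ) renaming (zero to fzero; suc to fsuc)
import Data.Fin as F
open import Relation.Nullary using (yes; no)
open import Data.Vec using (tabulate)
open import Data.Fin.Subset using (Subset; ⊤; ∣_∣)
open import Data.Vec using (Vec; lookup)
open import Data.Bool using (Bool; true; false; if_then_else_)
open import Data.List using (List; length)
open import Data.List.Membership.Propositional using (_∈_)
open import Data.List.Relation.Unary.Unique.Propositional using (Unique)
open import Data.Product using (Σ; _×_)
open import Relation.Binary.PropositionalEquality using (_≡_)
open import Relation.Nullary using (¬_)
open import Function.Bundles using (_⇔_)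
open import Data.Nat.Combinatorics using (_C_)

Point : ℕ → Set
Point d = Vec ℤ d

sumℚ : (n : ℕ) → (Fin n → ℚ) → ℚ
sumℚ zero    f = 0ℚ
sumℚ (suc n) f = f fzero ℚ.+ sumℚ n (λ i → f (fsuc i))

sumℤ≤ : ℕ → (ℕ → ℤ) → ℤ
sumℤ≤ zero    f = f 0
sumℤ≤ (suc n) f = sumℤ≤ n f ℤ.+ f (suc n)

toℚ : ℤ → ℚ
toℚ z = z ℚ./ 1

coord : {d : ℕ} → Point d → Fin d → ℚ
coord p i = toℚ (lookup p i)

eval : {d m : ℕ} → (Fin m → Point d) → (Fin d → ℚ) → Fin m → ℚ
eval {d} V a j = sumℚ d (λ i → a i ℚ.* coord (V j) i)

-- F ⊆ vertex indices is the vertex set of a face of conv(V):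
-- cut out by a (weakly) supporting hyperplane a·x ≤ b (the empty face allowed).
IsFace : {d m : ℕ} → (Fin m → Point d) → Subset m → Set
IsFace {d} {m} V F =
  Σ (Fin d → ℚ) λ a → Σ ℚ λ b →
    ((j : Fin m) → eval V a j ℚ.≤ b) ×
    ((j : Fin m) → (lookup F j ≡ true) ⇔ (eval V a j ≡ b))

BoundaryFace : {d m : ℕ} → (Fin m → Point d) → Subset m → Set
BoundaryFace V F = IsFace V F × ¬ (F ≡ ⊤)

AllVertices : {d m : ℕ} → (Fin m → Point d) → Set
AllVertices {d} {m} V = (j : Fin m) →
  IsFace V (tabulate (λ k → single k j))
  where
  single : Fin m → Fin m → Bool
  single k j with k F.≟ j
  ... | yes _ = true
  ... | no _ = false

AffIndep : {d m : ℕ} → (Fin m → Point d) → Subset m → Set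
AffIndep {d} {m} V F = (c : Fin m → ℚ) →
  ((j : Fin m) → lookup F j ≡ false → c j ≡ 0ℚ) →
  sumℚ m c ≡ 0ℚ →
  ((i : Fin d) → sumℚ m (λ j → c j ℚ.* coord (V j) i) ≡ 0ℚ) →
  (j : Fin m) → c j ≡ 0ℚ

FullDim : {d m : ℕ} → (Fin m → Point d) → Set
FullDim {d} {m} V = Σ (Subset m) λ F → ∣ F ∣ ≡ suc d × AffIndep V F

Simplicial : {d m : ℕ} → (Fin m → Point d) → Set
Simplicial V = ∀ F → BoundaryFace V F → AffIndep V F

-- facets: faces of dimension d-1 (for a simplicial polytope: d vertices)
Facet : {d m : ℕ} → (Fin m → Point d) → Subset m → Set
Facet {d} V F = BoundaryFace V F × ∣ F ∣ ≡ d

HasCount : {A : Set} → (A → Set) → ℕ → Set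
HasCount {A} P k = Σ (List A) λ xs →
  Unique xs × length xs ≡ k × ((x : A) → P x ⇔ (x ∈ xs))

InDilate : {d m : ℕ} → (Fin m → Point d) → Subset m → ℕ → Point d → Set
InDilate {d} {m} V F n z = Σ (Fin m → ℚ) λ l →
  ((j : Fin m) → 0ℚ ℚ.≤ l j) ×
  ((j : Fin m) → lookup F j ≡ false → l j ≡ 0ℚ) ×
  (sumℚ m l ≡ 1ℚ) ×
  ((i : Fin d) → coord z i ≡ toℚ (+ n) ℚ.* sumℚ m (λ j → l j ℚ.* coord (V j) i))

-- coefficient of λ^n in (1-λ)^(e+1) * Σ_n c_n λ^n
seriesCoeff : ℕ → (ℕ → ℕ) → ℕ → ℤ
seriesCoeff e c n = sumℤ≤ n (λ k → sign k ℤ.* (+ ((suc e) C k)) ℤ.* (+ c (n ∸ k)))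
  where
  sign : ℕ → ℤ
  sign zero = + 1
  sign (suc k) = - sign k

-- The polytope Q = conv{V j : j ∈ F} of dimension e has normalized volume v:
-- with c_0 = 1, c_n = |nQ ∩ ℤ^d|, the δ-vector (δ_0,…,δ_e) is given by the
-- coefficients of (1-λ)^(e+1) Σ c_n λ^n (which vanish beyond degree e) and v = Σ δ_i.
NormVol : {d m : ℕ} → (Fin m → Point d) → Subset m → (e : ℕ) → ℤ → Set
NormVol {d} V F e v = Σ (ℕ → ℕ) λ c →
  (c 0 ≡ 1) ×
  ((n : ℕ) → 1 ≤ n → HasCount (InDilate V F n) (c n)) ×
  ((n : ℕ) → e < n → seriesCoeff e c n ≡ + 0) ×
  (sumℤ≤ e (seriesCoeff e c) ≡ v)

-- h-vector of the boundary complex is h (h i for i = 0..d):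
-- f k = number of boundary faces with k vertices (= f_{k-1}, faces of dimension k-1,
-- as all boundary faces are simplices), and Σ h_i x^(d-i) = Σ f_{i-1} (x-1)^(d-i).
HVector : {d m : ℕ} → (Fin m → Point d) → (ℕ → ℤ) → Set
HVector {d} V h = Σ (ℕ → ℕ) λ f →
  ((k : ℕ) → k ≤ d → HasCount (λ F → BoundaryFace V F × ∣ F ∣ ≡ k) (f k)) ×
  ((x : ℤ) → sumℤ≤ d (λ i → h i ℤ.* (x ℤ.^ (d ∸ i)))
           ≡ sumℤ≤ d (λ i → (+ f i) ℤ.* ((x ℤ.- + 1) ℤ.^ (d ∸ i))))

hvec : ℕ → ℕ → ℕ → ℤ
hvec d h1 i with i ℕ.≟ 0 | i ℕ.≟ d
... | yes _ | _ = + 1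
... | no _ | yes _ = + 1
... | no _ | no _ = + h1

{-# OPTIONS --safe #-}

-- Put n = d - 1 and write the coordinates of ℝᵈ as (a, w₁, …, wₙ).  The polytope is the convex hull of
-- the n unit points e_x (a = 0, w = the x-th unit vector) and the h₁ + 1 points v_s = (s, s², …, s²)
-- for 0 ≤ s ≤ h₁.  An affine function with values u_x at the e_x, constant term γ and a-coefficient β
-- takes the value (Σ u - nγ)s² + βs + γ at v_s, so its behaviour along the curve is that of a
-- quadratic polynomial in s.
--
-- Faces: if some e_x is missing from a face, then (after scaling) the quadratic can be any of
-- (s - i)(s - i - 1), (s - i)² and s² + 1, so that the face contains v_i and v_{i+1}, or v_i, or no
-- v_s.  If all e_x are present, one finds only s, (h₁ - s)(1 + n h₁ s) and 1 + n s (h₁ - s), and the face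
-- contains v₀, or v_{h₁}, or no v_s.  There are no other proper faces: for i < l < j a positive
-- combination of v_i and v_j equals a positive combination of v_l and all the e_x, so a nonnegative
-- affine function vanishes on {v_i, v_j} iff it vanishes on {v_l} ∪ {e_x}.
--
-- Each of these faces carries integral affine functions dual to its vertices, which makes it a
-- unimodular simplex: the lattice points of its N-th dilate are the compositions of N, whose
-- generating function is (1 - λ)^(-d) for a facet.  With y = x - 1 and g = 1 + x + … + x^(n-1),
-- counting faces gives Σ f_{i-1} y^(d-i) = g (y² + (h₁ + 1) y + h₁) + y + 2, the required h-polynomial.

module Submission where

open import Defs
open import Data.Nat as ℕ using (ℕ; zero; suc; _∸_; _<_; _≤_; z≤n; s≤s)
import Data.Nat.Properties as ℕ
open import Data.Nat.Combinatorics using (_C_; nCk+nC[k+1]≡[n+1]C[k+1])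
open import Data.Nat.Coprimality as Coprime using (1-coprimeTo)
open import Data.Integer as ℤ using (ℤ; +_; -[1+_]; -_)
import Data.Integer.Properties as ℤ
open import Data.Integer.Tactic.RingSolver using (solve-∀)
import Data.Sign as Sign
open import Data.Rational as ℚ using (ℚ; mkℚ; 0ℚ; 1ℚ)
import Data.Rational.Properties as ℚ
open import Data.Rational.Solver using (module +-*-Solver)
open import Data.Bool using (Bool; true; false)
open import Data.Fin as Fin using (Fin; zero; suc; _↑ˡ_; _↑ʳ_; toℕ; fromℕ)
import Data.Fin.Properties as Fin
open import Data.Fin.Subset using (Subset; ∣_∣; ⊥; ⊤; ⁅_⁆; ∁)
import Data.Fin.Subset.Properties as Subset
open import Data.Vec as Vec using (Vec; []; _∷_; lookup; tabulate; replicate) renaming (_++_ to _++ᵛ_)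
import Data.Vec.Properties as Vec
open import Data.List using (List; length; map; filter; allFin; cartesianProductWith; _++_) renaming ([] to []ᴸ; _∷_ to _∷ᴸ_)
import Data.List.Properties as List
open import Data.List.Membership.Propositional using (_∈_)
import Data.List.Membership.Propositional.Properties as ∈
open import Data.List.Relation.Unary.Any using (here; there)
open import Data.List.Relation.Unary.All as All using (All; []; _∷_)
import Data.List.Relation.Unary.All.Properties as All
open import Data.List.Relation.Unary.AllPairs using ([]; _∷_)
open import Data.List.Relation.Unary.Unique.Propositional using (Unique)
import Data.List.Relation.Unary.Unique.Propositional.Properties as Unique
open import Data.Product using (Σ; ∃; _×_; _,_; proj₁; proj₂)
open import Data.Sum using (_⊎_; inj₁; inj₂; [_,_]′)
open import Function.Base using (_∘_)
open import Function.Bundles using (_⇔_; mk⇔; module Equivalence)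
open import Relation.Nullary using (Dec; ¬_; yes; no; contradiction)
open import Relation.Binary.Definitions using (tri<; tri≈; tri>)
open import Relation.Binary.PropositionalEquality as ≡ using (_≡_; _≢_; refl; trans; cong; cong₂; subst; subst₂; module ≡-Reasoning)

-- Finite sums of rationals

-- `toℚ` divides by 1 through gcd normalisation, which is stuck on a variable. This literal normal
-- form shows its numerator and denominator, so the arithmetic of ℚ computes on it.
fromℤ : ℤ → ℚ
fromℤ z = mkℚ z 0 (Coprime.sym (1-coprimeTo _))

toℚ-fromℤ : ∀ z → toℚ z ≡ fromℤ z
toℚ-fromℤ z = ℚ.↥p/↧p≡p (fromℤ z)

toℚ-+ : ∀ a b → toℚ (a ℤ.+ b) ≡ toℚ a ℚ.+ toℚ b
toℚ-+ a b rewrite toℚ-fromℤ a | toℚ-fromℤ b =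
  cong toℚ (≡.sym (cong₂ ℤ._+_ (ℤ.*-identityʳ a) (ℤ.*-identityʳ b)))

toℚ-* : ∀ a b → toℚ (a ℤ.* b) ≡ toℚ a ℚ.* toℚ b
toℚ-* a b rewrite toℚ-fromℤ a | toℚ-fromℤ b = refl

toℚ-injective : ∀ {a b} → toℚ a ≡ toℚ b → a ≡ b
toℚ-injective {a} {b} eq =
  cong ℚ.numerator (trans (≡.sym (toℚ-fromℤ a)) (trans eq (toℚ-fromℤ b)))

toℚ-mono : ∀ {a b} → a ℤ.≤ b → toℚ a ℚ.≤ toℚ b
toℚ-mono {a} {b} a≤b rewrite toℚ-fromℤ a | toℚ-fromℤ b =
  ℚ.*≤* (subst₂ ℤ._≤_ (≡.sym (ℤ.*-identityʳ a)) (≡.sym (ℤ.*-identityʳ b)) a≤b)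

toℚ-cancel-≤ : ∀ {a b} → toℚ a ℚ.≤ toℚ b → a ℤ.≤ b
toℚ-cancel-≤ {a} {b} p rewrite toℚ-fromℤ a | toℚ-fromℤ b with p
... | ℚ.*≤* q = subst₂ ℤ._≤_ (ℤ.*-identityʳ a) (ℤ.*-identityʳ b) q

sum-cong : ∀ n {f g : Fin n → ℚ} → (∀ i → f i ≡ g i) → sumℚ n f ≡ sumℚ n g
sum-cong zero    eq = refl
sum-cong (suc n) eq = cong₂ ℚ._+_ (eq zero) (sum-cong n (λ i → eq (suc i)))

sum-zero : ∀ n {f : Fin n → ℚ} → (∀ i → f i ≡ 0ℚ) → sumℚ n f ≡ 0ℚ
sum-zero zero    eq = refl
sum-zero (suc n) eq = cong₂ ℚ._+_ (eq zero) (sum-zero n (λ i → eq (suc i)))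

sum-+ : ∀ n (f g : Fin n → ℚ) → sumℚ n (λ i → f i ℚ.+ g i) ≡ sumℚ n f ℚ.+ sumℚ n g
sum-+ zero    f g = refl
sum-+ (suc n) f g rewrite sum-+ n (λ i → f (suc i)) (λ i → g (suc i)) =
  solve 4 (λ a b c d → (a :+ b) :+ (c :+ d) := (a :+ c) :+ (b :+ d)) refl (f zero) (g zero) _ _
  where open +-*-Solver

sum-minus : ∀ n (f g : Fin n → ℚ) → sumℚ n (λ i → f i ℚ.- g i) ≡ sumℚ n f ℚ.- sumℚ n g
sum-minus zero    f g = refl
sum-minus (suc n) f g rewrite sum-minus n (λ i → f (suc i)) (λ i → g (suc i)) =
  solve 4 (λ a b c d → (a :- b) :+ (c :- d) := (a :+ c) :- (b :+ d)) refl (f zero) (g zero) _ _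
  where open +-*-Solver

sum-*ˡ : ∀ n c (f : Fin n → ℚ) → sumℚ n (λ i → c ℚ.* f i) ≡ c ℚ.* sumℚ n f
sum-*ˡ zero    c f = ≡.sym (ℚ.*-zeroʳ c)
sum-*ˡ (suc n) c f rewrite sum-*ˡ n c (λ i → f (suc i)) = ≡.sym (ℚ.*-distribˡ-+ c (f zero) _)

sum-*ʳ : ∀ n c (f : Fin n → ℚ) → sumℚ n (λ i → f i ℚ.* c) ≡ sumℚ n f ℚ.* c
sum-*ʳ n c f = trans (sum-cong n (λ i → ℚ.*-comm (f i) c)) (trans (sum-*ˡ n c f) (ℚ.*-comm c _))

sum-swap : ∀ m n (f : Fin m → Fin n → ℚ) →
  sumℚ m (λ i → sumℚ n (f i)) ≡ sumℚ n (λ j → sumℚ m (λ i → f i j))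
sum-swap zero    n f = ≡.sym (sum-zero n (λ _ → refl))
sum-swap (suc m) n f rewrite sum-swap m n (λ i → f (suc i)) = ≡.sym (sum-+ n (f zero) _)

sum-single : ∀ n (f : Fin n → ℚ) i → (∀ j → j ≢ i → f j ≡ 0ℚ) → sumℚ n f ≡ f i
sum-single (suc n) f zero    eq =
  trans (cong (f zero ℚ.+_) (sum-zero n (λ j → eq (suc j) λ ()))) (ℚ.+-identityʳ _)
sum-single (suc n) f (suc i) eq =
  trans (cong₂ ℚ._+_ (eq zero λ ()) (sum-single n (λ j → f (suc j)) i (λ j j≢i → eq (suc j) (λ e → j≢i (Fin.suc-injective e)))))
        (ℚ.+-identityˡ _)

sum-split : ∀ m n (f : Fin (m ℕ.+ n) → ℚ) →
  sumℚ (m ℕ.+ n) f ≡ sumℚ m (λ i → f (i Fin.↑ˡ n)) ℚ.+ sumℚ n (λ j → f (m Fin.↑ʳ j))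
sum-split zero    n f = ≡.sym (ℚ.+-identityˡ _)
sum-split (suc m) n f rewrite sum-split m n (λ i → f (suc i)) = ≡.sym (ℚ.+-assoc (f zero) _ _)

sum-const : ∀ n c → sumℚ n (λ _ → c) ≡ toℚ (+ n) ℚ.* c
sum-const zero    c = ≡.sym (ℚ.*-zeroˡ c)
sum-const (suc n) c rewrite sum-const n c | toℚ-+ (+ 1) (+ n) =
  solve 2 (λ c n → c :+ n :* c := (con 1ℚ :+ n) :* c) refl c (toℚ (+ n))
  where open +-*-Solver

sum-nonneg : ∀ n {f : Fin n → ℚ} → (∀ i → 0ℚ ℚ.≤ f i) → 0ℚ ℚ.≤ sumℚ n f
sum-nonneg zero    p = ℚ.≤-refl
sum-nonneg (suc n) p = ℚ.+-mono-≤ (p zero) (sum-nonneg n (λ i → p (suc i)))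

nonneg+≡0⇒≡0ˡ : ∀ {p q} → 0ℚ ℚ.≤ p → 0ℚ ℚ.≤ q → p ℚ.+ q ≡ 0ℚ → p ≡ 0ℚ
nonneg+≡0⇒≡0ˡ {p} {q} 0≤p 0≤q eq = ℚ.≤-antisym
  (ℚ.≤-trans (ℚ.≤-reflexive (≡.sym (ℚ.+-identityʳ p)))
    (ℚ.≤-trans (ℚ.+-monoʳ-≤ p 0≤q) (ℚ.≤-reflexive eq))) 0≤p

nonneg+≡0⇒≡0ʳ : ∀ {p q} → 0ℚ ℚ.≤ p → 0ℚ ℚ.≤ q → p ℚ.+ q ≡ 0ℚ → q ≡ 0ℚ
nonneg+≡0⇒≡0ʳ {p} {q} 0≤p 0≤q eq = nonneg+≡0⇒≡0ˡ 0≤q 0≤p (trans (ℚ.+-comm q p) eq)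

sum-nonneg-zero : ∀ n {f : Fin n → ℚ} → (∀ i → 0ℚ ℚ.≤ f i) → sumℚ n f ≡ 0ℚ → ∀ i → f i ≡ 0ℚ
sum-nonneg-zero (suc n) p eq zero    =
  nonneg+≡0⇒≡0ˡ (p zero) (sum-nonneg n (λ i → p (suc i))) eq
sum-nonneg-zero (suc n) p eq (suc i) =
  sum-nonneg-zero n (λ i → p (suc i)) (nonneg+≡0⇒≡0ʳ (p zero) (sum-nonneg n (λ i → p (suc i))) eq) i

sumℤ : ∀ n → (Fin n → ℤ) → ℤ
sumℤ zero    f = + 0
sumℤ (suc n) f = f zero ℤ.+ sumℤ n (λ i → f (suc i))

toℚ-sum : ∀ n (f : Fin n → ℤ) → toℚ (sumℤ n f) ≡ sumℚ n (λ i → toℚ (f i))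
toℚ-sum zero    f = refl
toℚ-sum (suc n) f = trans (toℚ-+ (f zero) _) (cong (toℚ (f zero) ℚ.+_) (toℚ-sum n _))

minus≡0 : ∀ {p q} → p ≡ q → q ℚ.- p ≡ 0ℚ
minus≡0 {p} refl = ℚ.+-inverseʳ p

minus≡0⁻ : ∀ {p q} → q ℚ.- p ≡ 0ℚ → p ≡ q
minus≡0⁻ {p} {q} e = trans (≡.sym (ℚ.+-identityˡ p)) (trans (cong (ℚ._+ p) (≡.sym e)) (lemma q p))
  where
  lemma : ∀ q p → q ℚ.- p ℚ.+ p ≡ q
  lemma = solve 2 (λ q p → q :- p :+ p := q) refl
    where open +-*-Solver

minus-nonneg : ∀ {p q} → p ℚ.≤ q → 0ℚ ℚ.≤ q ℚ.- p
minus-nonneg {p} {q} p≤q = subst (ℚ._≤ q ℚ.- p) (ℚ.+-inverseʳ p) (ℚ.+-monoˡ-≤ (ℚ.- p) p≤q)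

-- Unimodular simplices and their lattice points

affine : ∀ {d m} → (Fin m → Point d) → (Fin d → ℤ) → ℤ → Fin m → ℚ
affine V a b j = eval V (toℚ ∘ a) j ℚ.+ toℚ b

-- Integral affine functions dual to the points of S: they exist exactly when conv(S) is a simplex
-- that is unimodular for the lattice points of its affine hull.
Unimodular : ∀ {d m} → (Fin m → Point d) → Subset m → Set
Unimodular {d} {m} V S = (j : Fin m) → lookup S j ≡ true →
  Σ (Fin d → ℤ) λ a → Σ ℤ λ b →
    affine V a b j ≡ 1ℚ ×
    ((j′ : Fin m) → lookup S j′ ≡ true → j′ ≢ j → affine V a b j′ ≡ 0ℚ)

-- Summing the dual function of `j` against the weights leaves only `c j`, and interchanging the two
-- sums expresses the result by the weighted point sum and the total weight. Hence each weight is an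
-- integral linear function of these data, which yields both affine independence and integrality.
weight-from-dual : ∀ {d m} {V : Fin m → Point d} {S : Subset m} (c : Fin m → ℚ) →
  (∀ j → lookup S j ≡ false → c j ≡ 0ℚ) →
  ∀ {j a b} → affine V a b j ≡ 1ℚ →
  (∀ j′ → lookup S j′ ≡ true → j′ ≢ j → affine V a b j′ ≡ 0ℚ) →
  c j ≡ sumℚ d (λ i → toℚ (a i) ℚ.* sumℚ m (λ j′ → c j′ ℚ.* coord (V j′) i)) ℚ.+ toℚ b ℚ.* sumℚ m c
weight-from-dual {d} {m} {V} {S} c supp {j} {a} {b} dual≡1 dual≡0 = begin
  c j
    ≡⟨ ℚ.*-identityʳ (c j) ⟨
  c j ℚ.* 1ℚ
    ≡⟨ cong (c j ℚ.*_) dual≡1 ⟨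
  c j ℚ.* affine V a b j
    ≡⟨ sum-single m (λ j′ → c j′ ℚ.* affine V a b j′) j other ⟨
  sumℚ m (λ j′ → c j′ ℚ.* affine V a b j′)
    ≡⟨ sum-cong m (λ j′ → ℚ.*-distribˡ-+ (c j′) _ _) ⟩
  sumℚ m (λ j′ → c j′ ℚ.* eval V (toℚ ∘ a) j′ ℚ.+ c j′ ℚ.* toℚ b)
    ≡⟨ sum-+ m _ _ ⟩
  sumℚ m (λ j′ → c j′ ℚ.* eval V (toℚ ∘ a) j′) ℚ.+ sumℚ m (λ j′ → c j′ ℚ.* toℚ b)
    ≡⟨ cong₂ ℚ._+_ linear (trans (sum-*ʳ m (toℚ b) c) (ℚ.*-comm _ (toℚ b))) ⟩
  _ ∎
  where
  open ≡-Reasoning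
  other : ∀ j′ → j′ ≢ j → c j′ ℚ.* affine V a b j′ ≡ 0ℚ
  other j′ j′≢j with lookup S j′ in eq
  ... | true  = trans (cong (c j′ ℚ.*_) (dual≡0 j′ eq j′≢j)) (ℚ.*-zeroʳ (c j′))
  ... | false = trans (cong (ℚ._* affine V a b j′) (supp j′ eq)) (ℚ.*-zeroˡ (affine V a b j′))
  swap : ∀ p q r → p ℚ.* (q ℚ.* r) ≡ q ℚ.* (p ℚ.* r)
  swap = solve 3 (λ p q r → p :* (q :* r) := q :* (p :* r)) refl
    where open +-*-Solver
  linear : sumℚ m (λ j′ → c j′ ℚ.* eval V (toℚ ∘ a) j′)
         ≡ sumℚ d (λ i → toℚ (a i) ℚ.* sumℚ m (λ j′ → c j′ ℚ.* coord (V j′) i))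
  linear = begin
    sumℚ m (λ j′ → c j′ ℚ.* sumℚ d (λ i → toℚ (a i) ℚ.* coord (V j′) i))
      ≡⟨ sum-cong m (λ j′ → ≡.sym (sum-*ˡ d (c j′) _)) ⟩
    sumℚ m (λ j′ → sumℚ d (λ i → c j′ ℚ.* (toℚ (a i) ℚ.* coord (V j′) i)))
      ≡⟨ sum-swap m d _ ⟩
    sumℚ d (λ i → sumℚ m (λ j′ → c j′ ℚ.* (toℚ (a i) ℚ.* coord (V j′) i)))
      ≡⟨ sum-cong d (λ i → trans (sum-cong m (λ j′ → swap (c j′) (toℚ (a i)) _)) (sum-*ˡ m (toℚ (a i)) _)) ⟩
    _ ∎

-- For an affine dependency the total weight and the weighted point sum vanish, and every weight on
-- `S` is linear in them.
unimodular⇒affIndep : ∀ {d m} {V : Fin m → Point d} {S} → Unimodular V S → AffIndep V S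
unimodular⇒affIndep {d} {m} {V} {S} dual c supp sum≡0 comb≡0 j with lookup S j in eq
... | false = supp j eq
... | true  = let a , b , dual≡1 , dual≡0 = dual j eq in
  trans (weight-from-dual {V = V} {S = S} c supp {a = a} {b = b} dual≡1 dual≡0)
    (cong₂ ℚ._+_
      (sum-zero d (λ i → trans (cong (toℚ (a i) ℚ.*_) (comb≡0 i)) (ℚ.*-zeroʳ (toℚ (a i)))))
      (trans (cong (toℚ b ℚ.*_) sum≡0) (ℚ.*-zeroʳ (toℚ b))))

sumℕ : ∀ {m} → Vec ℕ m → ℕ
sumℕ []       = 0
sumℕ (x ∷ xs) = x ℕ.+ sumℕ xs

sucHead : ∀ {m} → Vec ℕ (suc m) → Vec ℕ (suc m)
sucHead (x ∷ xs) = suc x ∷ xs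

-- The first entry is either zero or can be lowered by one. This split matches the recursion of
-- `#compositions`, on which the generating function rests.
compositions : ∀ {m} → Subset m → ℕ → List (Vec ℕ m)
compositions []          zero    = [] ∷ᴸ []ᴸ
compositions []          (suc n) = []ᴸ
compositions (false ∷ S) n       = map (0 ∷_) (compositions S n)
compositions (true ∷ S)  zero    = map (0 ∷_) (compositions S zero)
compositions (true ∷ S)  (suc n) =
  map (0 ∷_) (compositions S (suc n)) ++ map sucHead (compositions (true ∷ S) n)

-- For fixed `s` these are the coefficients of (1 - λ)^(-s).
#compositions : ℕ → ℕ → ℕ
#compositions zero    zero    = 1
#compositions zero    (suc n) = 0
#compositions (suc s) zero    = #compositions s zero
#compositions (suc s) (suc n) = #compositions s (suc n) ℕ.+ #compositions (suc s) n

length-compositions : ∀ {m} (S : Subset m) n → length (compositions S n) ≡ #compositions ∣ S ∣ n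
length-compositions []          zero    = refl
length-compositions []          (suc n) = refl
length-compositions (false ∷ S) n       = trans (List.length-map _ (compositions S n)) (length-compositions S n)
length-compositions (true ∷ S)  zero    = trans (List.length-map _ (compositions S zero)) (length-compositions S zero)
length-compositions (true ∷ S)  (suc n) = trans
  (List.length-++ (map (0 ∷_) (compositions S (suc n))))
  (cong₂ ℕ._+_ (trans (List.length-map _ (compositions S (suc n))) (length-compositions S (suc n)))
               (trans (List.length-map _ (compositions (true ∷ S) n)) (length-compositions (true ∷ S) n)))

∷-injʳ : ∀ {m} {x : ℕ} {u v : Vec ℕ m} → x ∷ u ≡ x ∷ v → u ≡ v
∷-injʳ refl = refl

sucHead-injective : ∀ {m} {u v : Vec ℕ (suc m)} → sucHead u ≡ sucHead v → u ≡ v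
sucHead-injective {u = x ∷ u} {v = .x ∷ .u} refl = refl

unique-compositions : ∀ {m} (S : Subset m) n → Unique (compositions S n)
unique-compositions []          zero    = [] ∷ []
unique-compositions []          (suc n) = []
unique-compositions (false ∷ S) n       = Unique.map⁺ ∷-injʳ (unique-compositions S n)
unique-compositions (true ∷ S)  zero    = Unique.map⁺ ∷-injʳ (unique-compositions S zero)
unique-compositions (true ∷ S)  (suc n) = Unique.++⁺
  (Unique.map⁺ ∷-injʳ (unique-compositions S (suc n)))
  (Unique.map⁺ sucHead-injective (unique-compositions (true ∷ S) n))
  disjoint
  where
  disjoint : ∀ {u} → ¬ (u ∈ map (0 ∷_) (compositions S (suc n)) × u ∈ map sucHead (compositions (true ∷ S) n))
  disjoint (p , q) with ∈.∈-map⁻ (0 ∷_) p | ∈.∈-map⁻ sucHead q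
  ... | _ , _ , refl | (_ ∷ _) , _ , ()

SupportedOn : ∀ {m} → Subset m → Vec ℕ m → Set
SupportedOn S u = ∀ j → lookup S j ≡ false → lookup u j ≡ 0

compositions⁺ : ∀ {m} (S : Subset m) u → SupportedOn S u → u ∈ compositions S (sumℕ u)
compositions⁺ []          []          supp = here refl
compositions⁺ (false ∷ S) (x ∷ u)     supp with supp zero refl
... | refl = ∈.∈-map⁺ (0 ∷_) (compositions⁺ S u (supp ∘ suc))
-- When the head lies in `S`, `compositions` matches on the total, so the total is abstracted
-- together with the membership proof.
compositions⁺ (true ∷ S)  (zero ∷ u)  supp with sumℕ u | compositions⁺ S u (supp ∘ suc)
... | zero  | u∈ = ∈.∈-map⁺ (0 ∷_) u∈
... | suc _ | u∈ = ∈.∈-++⁺ˡ (∈.∈-map⁺ (0 ∷_) u∈)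
compositions⁺ (true ∷ S)  (suc x ∷ u) supp =
  ∈.∈-++⁺ʳ _ (∈.∈-map⁺ sucHead (compositions⁺ (true ∷ S) (x ∷ u) λ { zero () ; (suc j) → supp (suc j) }))

IsComposition : ∀ {m} → Subset m → ℕ → Vec ℕ m → Set
IsComposition S n u = SupportedOn S u × sumℕ u ≡ n

0∷⁺ : ∀ {m b} {S : Subset m} {n u} → IsComposition S n u → IsComposition (b ∷ S) n (0 ∷ u)
0∷⁺ (supp , eq) = (λ { zero _ → refl ; (suc j) → supp j }) , eq

all-compositions : ∀ {m} (S : Subset m) n → All (IsComposition S n) (compositions S n)
all-compositions []          zero    = ((λ ()) , refl) ∷ []
all-compositions []          (suc n) = []
all-compositions (false ∷ S) n       = All.map⁺ (All.map 0∷⁺ (all-compositions S n))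
all-compositions (true ∷ S)  zero    = All.map⁺ (All.map 0∷⁺ (all-compositions S zero))
all-compositions (true ∷ S)  (suc n) = All.++⁺
  (All.map⁺ (All.map 0∷⁺ (all-compositions S (suc n))))
  (All.map⁺ (All.map (λ {u} → sucHead⁺ {u}) (all-compositions (true ∷ S) n)))
  where
  sucHead⁺ : ∀ {u} → IsComposition (true ∷ S) n u → IsComposition (true ∷ S) (suc n) (sucHead u)
  sucHead⁺ {x ∷ u} (supp , eq) = (λ { zero () ; (suc j) → supp (suc j) }) , cong suc eq

compositions⁻ : ∀ {m} (S : Subset m) n {u} → u ∈ compositions S n → IsComposition S n u
compositions⁻ S n = All.lookup (all-compositions S n)

toℚ-sumℕ : ∀ {m} (u : Vec ℕ m) → sumℚ m (λ j → toℚ (+ lookup u j)) ≡ toℚ (+ sumℕ u)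
toℚ-sumℕ []      = refl
toℚ-sumℕ (x ∷ u) = trans (cong (toℚ (+ x) ℚ.+_) (toℚ-sumℕ u)) (≡.sym (toℚ-+ (+ x) (+ sumℕ u)))

-- Injectivity is asked only on members of the list, because `combination` is shown injective only
-- among compositions of one common total.
unique-map : ∀ {A B : Set} (f : A → B) {xs : List A} →
  (∀ {x y} → x ∈ xs → y ∈ xs → f x ≡ f y → x ≡ y) → Unique xs → Unique (map f xs)
unique-map f inj []           = []
unique-map f inj (x∉xs ∷ xs!) =
  All.map⁺ (All.tabulate λ y∈ fx≡fy → All.lookup x∉xs y∈ (inj (here refl) (there y∈) fx≡fy))
  ∷ unique-map f (λ p q → inj (there p) (there q)) xs!

combination : ∀ {d m} → (Fin m → Point d) → Vec ℕ m → Point d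
combination {m = m} V u = tabulate λ i → sumℤ m (λ j → + lookup u j ℤ.* lookup (V j) i)

coord-combination : ∀ {d m} (V : Fin m → Point d) u i →
  coord (combination V u) i ≡ sumℚ m (λ j → toℚ (+ lookup u j) ℚ.* coord (V j) i)
coord-combination {m = m} V u i = trans
  (cong toℚ (Vec.lookup∘tabulate (λ i → sumℤ m (λ j → + lookup u j ℤ.* lookup (V j) i)) i))
  (trans (toℚ-sum m _) (sum-cong m (λ j → toℚ-* (+ lookup u j) (lookup (V j) i))))

lookup-ext : ∀ {A : Set} {m} {u v : Vec A m} → (∀ j → lookup u j ≡ lookup v j) → u ≡ v
lookup-ext {u = u} {v} eq =
  trans (≡.sym (Vec.tabulate∘lookup u)) (trans (Vec.tabulate-cong eq) (Vec.tabulate∘lookup v))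

-- The difference of two compositions of `n` with the same combination is an affine dependency on
-- `S`: its weights add up to n - n = 0.
combination-injective : ∀ {d m} {V : Fin m → Point d} {S} → AffIndep V S → ∀ {n u v} →
  u ∈ compositions S n → v ∈ compositions S n → combination V u ≡ combination V v → u ≡ v
combination-injective {d} {m} {V} {S} indep {n} {u} {v} u∈ v∈ eq =
  lookup-ext λ j → ℤ.+-injective (toℚ-injective (≡.sym (minus≡0⁻ (c≡0 j))))
  where
  c : Fin m → ℚ
  c j = toℚ (+ lookup u j) ℚ.- toℚ (+ lookup v j)
  supp-u = proj₁ (compositions⁻ S n u∈)
  supp-v = proj₁ (compositions⁻ S n v∈)
  c≡0 : ∀ j → c j ≡ 0ℚ
  c≡0 = indep c
    (λ j eq → cong₂ (λ a b → toℚ (+ a) ℚ.- toℚ (+ b)) (supp-u j eq) (supp-v j eq))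
    (trans (sum-minus m _ _) (trans (cong₂ ℚ._-_
      (trans (toℚ-sumℕ u) (cong (toℚ ∘ +_) (proj₂ (compositions⁻ S n u∈))))
      (trans (toℚ-sumℕ v) (cong (toℚ ∘ +_) (proj₂ (compositions⁻ S n v∈)))))
      (ℚ.+-inverseʳ (toℚ (+ n)))))
    (λ i → trans (sum-cong m (λ j → distrib (toℚ (+ lookup u j)) (toℚ (+ lookup v j)) (coord (V j) i)))
      (trans (sum-minus m _ _) (trans (cong₂ ℚ._-_
        (≡.sym (coord-combination V u i)) (≡.sym (coord-combination V v i)))
        (trans (cong (λ z → coord z i ℚ.- coord (combination V v) i) eq) (ℚ.+-inverseʳ (coord (combination V v) i))))))
    where
    distrib : ∀ p q r → (p ℚ.- q) ℚ.* r ≡ p ℚ.* r ℚ.- q ℚ.* r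
    distrib = solve 3 (λ p q r → (p :- q) :* r := p :* r :- q :* r) refl
      where open +-*-Solver

-- The convex weights scaled by `n` are values of integral functions at integral data, hence
-- integers. Being nonnegative, they form a composition of `n`.
dilate⇒combination : ∀ {d m} {V : Fin m → Point d} {S} → Unimodular V S → ∀ n {z} →
  InDilate V S n z → z ∈ map (combination V) (compositions S n)
dilate⇒combination {d} {m} {V} {S} dual n {z} (l , l≥0 , supp , sum≡1 , z≡) =
  subst₂ (λ z n → z ∈ map (combination V) (compositions S n)) (≡.sym z≡u) sum-u
    (∈.∈-map⁺ (combination V) (compositions⁺ S u supp-u))
  where
  N = toℚ (+ n)
  t : Fin m → ℚ
  t j = N ℚ.* l j
  t-supp : ∀ j → lookup S j ≡ false → t j ≡ 0ℚ
  t-supp j eq = trans (cong (N ℚ.*_) (supp j eq)) (ℚ.*-zeroʳ N)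
  sum-t : sumℚ m t ≡ N
  sum-t = trans (sum-*ˡ m N l) (trans (cong (N ℚ.*_) sum≡1) (ℚ.*-identityʳ N))
  comb-t : ∀ i → sumℚ m (λ j → t j ℚ.* coord (V j) i) ≡ coord z i
  comb-t i = trans (sum-cong m (λ j → ℚ.*-assoc N (l j) (coord (V j) i)))
    (trans (sum-*ˡ m N _) (≡.sym (z≡ i)))
  t-integral : ∀ j → Σ ℤ λ w → t j ≡ toℚ w
  t-integral j with lookup S j in eq
  ... | false = + 0 , t-supp j eq
  ... | true  = let a , b , dual≡1 , dual≡0 = dual j eq in
    -- This is the dual function made homogeneous: its constant term is multiplied by the total
    -- weight `n`.
    sumℤ d (λ i → a i ℤ.* lookup z i) ℤ.+ b ℤ.* + n ,
    (begin
      t j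
        ≡⟨ weight-from-dual {V = V} {S = S} t t-supp {a = a} {b = b} dual≡1 dual≡0 ⟩
      sumℚ d (λ i → toℚ (a i) ℚ.* sumℚ m (λ j′ → t j′ ℚ.* coord (V j′) i)) ℚ.+ toℚ b ℚ.* sumℚ m t
        ≡⟨ cong₂ ℚ._+_
             (trans (sum-cong d (λ i → trans (cong (toℚ (a i) ℚ.*_) (comb-t i)) (≡.sym (toℚ-* (a i) (lookup z i)))))
                    (≡.sym (toℚ-sum d _)))
             (trans (cong (toℚ b ℚ.*_) sum-t) (≡.sym (toℚ-* b (+ n)))) ⟩
      toℚ (sumℤ d (λ i → a i ℤ.* lookup z i)) ℚ.+ toℚ (b ℤ.* + n)
        ≡⟨ toℚ-+ (sumℤ d (λ i → a i ℤ.* lookup z i)) (b ℤ.* + n) ⟨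
      _ ∎)
    where open ≡-Reasoning
  t≥0 : ∀ j → 0ℚ ℚ.≤ t j
  t≥0 j = ℚ.≤-trans (ℚ.≤-reflexive (≡.sym (ℚ.*-zeroʳ N)))
    (ℚ.*-monoˡ-≤-nonNeg N {{ℚ.nonNegative (toℚ-mono {+ 0} {+ n} (ℤ.+≤+ z≤n))}} (l≥0 j))
  t-natural : ∀ j → Σ ℕ λ w → t j ≡ toℚ (+ w)
  t-natural j with t-integral j
  ... | + w , eq      = w , eq
  ... | -[1+ w ] , eq with toℚ-cancel-≤ {+ 0} { -[1+ w ]} (subst (0ℚ ℚ.≤_) eq (t≥0 j))
  ...   | ()
  u : Vec ℕ m
  u = tabulate (λ j → proj₁ (t-natural j))
  u≡t : ∀ j → toℚ (+ lookup u j) ≡ t j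
  u≡t j = trans (cong (toℚ ∘ +_) (Vec.lookup∘tabulate (λ j → proj₁ (t-natural j)) j)) (≡.sym (proj₂ (t-natural j)))
  supp-u : SupportedOn S u
  supp-u j eq = ℤ.+-injective (toℚ-injective (trans (u≡t j) (t-supp j eq)))
  sum-u : sumℕ u ≡ n
  sum-u = ℤ.+-injective (toℚ-injective (trans (≡.sym (toℚ-sumℕ u)) (trans (sum-cong m u≡t) sum-t)))
  z≡u : z ≡ combination V u
  z≡u = lookup-ext λ i → toℚ-injective (≡.sym (trans (coord-combination V u i)
    (trans (sum-cong m (λ j → cong (ℚ._* coord (V j) i) (u≡t j))) (comb-t i))))

combination⇒dilate : ∀ {d m} {V : Fin m → Point d} {S} n {z} →
  z ∈ map (combination V) (compositions S (suc n)) → InDilate V S (suc n) z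
combination⇒dilate {d} {m} {V} {S} n z∈ with ∈.∈-map⁻ (combination V) z∈
... | u , u∈ , refl = l , l≥0 , supp , sum≡1 , coords
  where
  N = toℚ (+ suc n)
  -- Inverting the literal form lets the instances for nonzeroness, and later for the sign of the
  -- inverse, be found by computation.
  1/N = ℚ.1/ fromℤ (+ suc n)
  N*1/N : N ℚ.* 1/N ≡ 1ℚ
  N*1/N = trans (cong (ℚ._* 1/N) (toℚ-fromℤ (+ suc n))) (ℚ.*-inverseʳ (fromℤ (+ suc n)))
  l : Fin m → ℚ
  l j = 1/N ℚ.* toℚ (+ lookup u j)
  l≥0 : ∀ j → 0ℚ ℚ.≤ l j
  l≥0 j = ℚ.≤-trans (ℚ.≤-reflexive (≡.sym (ℚ.*-zeroʳ 1/N)))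
    (ℚ.*-monoˡ-≤-nonNeg 1/N (toℚ-mono {+ 0} {+ lookup u j} (ℤ.+≤+ z≤n)))
  supp : ∀ j → lookup S j ≡ false → l j ≡ 0ℚ
  supp j eq = trans (cong (λ w → 1/N ℚ.* toℚ (+ w)) (proj₁ (compositions⁻ S (suc n) u∈) j eq)) (ℚ.*-zeroʳ 1/N)
  sum≡1 : sumℚ m l ≡ 1ℚ
  sum≡1 = trans (sum-*ˡ m 1/N _) (trans
    (cong (1/N ℚ.*_) (trans (toℚ-sumℕ u) (cong (toℚ ∘ +_) (proj₂ (compositions⁻ S (suc n) u∈)))))
    (trans (ℚ.*-comm 1/N N) N*1/N))
  coords : ∀ i → coord (combination V u) i ≡ N ℚ.* sumℚ m (λ j → l j ℚ.* coord (V j) i)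
  coords i = begin
    coord (combination V u) i
      ≡⟨ coord-combination V u i ⟩
    X
      ≡⟨ trans (≡.sym (ℚ.*-identityˡ X)) (trans (cong (ℚ._* X) (≡.sym N*1/N)) (ℚ.*-assoc N 1/N X)) ⟩
    N ℚ.* (1/N ℚ.* X)
      ≡⟨ cong (N ℚ.*_) (≡.sym (trans (sum-cong m (λ j → ℚ.*-assoc 1/N (toℚ (+ lookup u j)) (coord (V j) i))) (sum-*ˡ m 1/N _))) ⟩
    _ ∎
    where
    open ≡-Reasoning
    X = sumℚ m (λ j → toℚ (+ lookup u j) ℚ.* coord (V j) i)

lattice-point-count : ∀ {d m} {V : Fin m → Point d} {S} → Unimodular V S → ∀ n → 1 ≤ n →
  HasCount (InDilate V S n) (#compositions ∣ S ∣ n)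
lattice-point-count {V = V} {S} dual (suc n) _ =
  map (combination V) (compositions S (suc n)) ,
  unique-map (combination V) (combination-injective {V = V} {S} (unimodular⇒affIndep {V = V} {S} dual)) (unique-compositions S (suc n)) ,
  trans (List.length-map _ (compositions S (suc n))) (length-compositions S (suc n)) ,
  λ z → mk⇔ (dilate⇒combination {V = V} {S} dual (suc n)) (combination⇒dilate {V = V} {S} n)

-- Generating functions and normalized volume

sumℤ≤-cong : ∀ n {f g : ℕ → ℤ} → (∀ k → k ≤ n → f k ≡ g k) → sumℤ≤ n f ≡ sumℤ≤ n g
sumℤ≤-cong zero    eq = eq 0 z≤n
sumℤ≤-cong (suc n) eq = cong₂ ℤ._+_ (sumℤ≤-cong n (λ k k≤n → eq k (ℕ.m≤n⇒m≤1+n k≤n))) (eq (suc n) ℕ.≤-refl)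

sumℤ≤-+ : ∀ n (f g : ℕ → ℤ) → sumℤ≤ n (λ k → f k ℤ.+ g k) ≡ sumℤ≤ n f ℤ.+ sumℤ≤ n g
sumℤ≤-+ zero    f g = refl
sumℤ≤-+ (suc n) f g = trans (cong (ℤ._+ (f (suc n) ℤ.+ g (suc n))) (sumℤ≤-+ n f g)) (lemma (sumℤ≤ n f) (sumℤ≤ n g) (f (suc n)) (g (suc n)))
  where
  lemma : ∀ a b c d → (a ℤ.+ b) ℤ.+ (c ℤ.+ d) ≡ (a ℤ.+ c) ℤ.+ (b ℤ.+ d)
  lemma = solve-∀

sumℤ≤-*ˡ : ∀ n c (f : ℕ → ℤ) → sumℤ≤ n (λ k → c ℤ.* f k) ≡ c ℤ.* sumℤ≤ n f
sumℤ≤-*ˡ zero    c f = refl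
sumℤ≤-*ˡ (suc n) c f = trans (cong (ℤ._+ c ℤ.* f (suc n)) (sumℤ≤-*ˡ n c f)) (≡.sym (ℤ.*-distribˡ-+ c (sumℤ≤ n f) (f (suc n))))

sumℤ≤-zero : ∀ n {f : ℕ → ℤ} → (∀ k → k ≤ n → f k ≡ + 0) → sumℤ≤ n f ≡ + 0
sumℤ≤-zero zero    eq = eq 0 z≤n
sumℤ≤-zero (suc n) eq = cong₂ ℤ._+_ (sumℤ≤-zero n (λ k k≤n → eq k (ℕ.m≤n⇒m≤1+n k≤n))) (eq (suc n) ℕ.≤-refl)

sumℤ≤-first : ∀ n (f : ℕ → ℤ) → sumℤ≤ (suc n) f ≡ f 0 ℤ.+ sumℤ≤ n (f ∘ suc)
sumℤ≤-first zero    f = refl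
sumℤ≤-first (suc n) f = trans (cong (ℤ._+ f (suc (suc n))) (sumℤ≤-first n f)) (ℤ.+-assoc (f 0) _ _)

sgn : ℕ → ℤ
sgn zero    = + 1
sgn (suc k) = - sgn k

-- Summed over k ≤ n this is the coefficient of λ^n in (1 - λ)^s times the generating function of
-- `c`.
term : ℕ → (ℕ → ℕ) → ℕ → ℕ → ℤ
term s c n k = sgn k ℤ.* + (s C k) ℤ.* + c (n ∸ k)

-- Multiplying the generating function of #compositions (suc s) by 1 - λ gives that of #compositions s.
term-sum-step : ∀ s n → sumℤ≤ n (term (suc s) (#compositions (suc s)) n) ≡ sumℤ≤ n (term s (#compositions s) n)
term-sum-step s zero    = refl
term-sum-step s (suc n) = begin
  sumℤ≤ (suc n) (term (suc s) c (suc n))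
    ≡⟨ sumℤ≤-first n _ ⟩
  + 1 ℤ.* + 1 ℤ.* + c (suc n) ℤ.+ sumℤ≤ n (λ k → term (suc s) c (suc n) (suc k))
    ≡⟨ cong (ℤ._+_ (+ 1 ℤ.* + 1 ℤ.* + c (suc n))) (trans (sumℤ≤-cong n (λ k _ → pascal k)) (sumℤ≤-+ n _ _)) ⟩
  + 1 ℤ.* + 1 ℤ.* + c (suc n) ℤ.+ (sumℤ≤ n (λ k → term s c (suc n) (suc k)) ℤ.+ sumℤ≤ n (λ k → - + 1 ℤ.* term s c n k))
    ≡⟨ ℤ.+-assoc (+ 1 ℤ.* + 1 ℤ.* + c (suc n)) _ _ ⟨
  + 1 ℤ.* + 1 ℤ.* + c (suc n) ℤ.+ sumℤ≤ n (λ k → term s c (suc n) (suc k)) ℤ.+ sumℤ≤ n (λ k → - + 1 ℤ.* term s c n k)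
    ≡⟨ cong (ℤ._+ sumℤ≤ n (λ k → - + 1 ℤ.* term s c n k)) (sumℤ≤-first n (term s c (suc n))) ⟨
  sumℤ≤ n (term s c (suc n)) ℤ.+ term s c (suc n) (suc n) ℤ.+ sumℤ≤ n (λ k → - + 1 ℤ.* term s c n k)
    ≡⟨ move (sumℤ≤ n (term s c (suc n))) _ _ ⟩
  sumℤ≤ n (term s c (suc n)) ℤ.+ sumℤ≤ n (λ k → - + 1 ℤ.* term s c n k) ℤ.+ term s c (suc n) (suc n)
    ≡⟨ cong₂ ℤ._+_ (trans (≡.sym (sumℤ≤-+ n _ _)) (sumℤ≤-cong n difference)) last ⟩
  sumℤ≤ n (term s c′ (suc n)) ℤ.+ term s c′ (suc n) (suc n) ∎
  where
  open ≡-Reasoning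
  c = #compositions (suc s)
  c′ = #compositions s
  move : ∀ x y z → x ℤ.+ y ℤ.+ z ≡ x ℤ.+ z ℤ.+ y
  move = solve-∀
  -- Pascal's rule extracts one factor 1 - λ from the binomial coefficients, and `difference`
  -- applies that factor to `c` by the recursion of `#compositions`. The index n + 1 is left to
  -- `last`, where both sequences are evaluated at 0 and agree.
  pascal : ∀ k → term (suc s) c (suc n) (suc k) ≡ term s c (suc n) (suc k) ℤ.+ - + 1 ℤ.* term s c n k
  pascal k rewrite ≡.sym (nCk+nC[k+1]≡[n+1]C[k+1] s k) | ℤ.pos-+ (s C k) (s C suc k) =
    lemma (sgn k) (+ (s C k)) (+ (s C suc k)) (+ c (n ∸ k))
    where
    lemma : ∀ σ x y z → - σ ℤ.* (x ℤ.+ y) ℤ.* z ≡ - σ ℤ.* y ℤ.* z ℤ.+ - + 1 ℤ.* (σ ℤ.* x ℤ.* z)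
    lemma = solve-∀
  difference : ∀ k → k ≤ n → term s c (suc n) k ℤ.+ - + 1 ℤ.* term s c n k ≡ term s c′ (suc n) k
  difference k k≤n rewrite ℕ.+-∸-assoc 1 k≤n | ℤ.pos-+ (c′ (suc (n ∸ k))) (c (n ∸ k)) =
    lemma (sgn k) (+ (s C k)) (+ c (n ∸ k)) (+ c′ (suc (n ∸ k)))
    where
    lemma : ∀ σ x y z → σ ℤ.* x ℤ.* (z ℤ.+ y) ℤ.+ - + 1 ℤ.* (σ ℤ.* x ℤ.* y) ≡ σ ℤ.* x ℤ.* z
    lemma = solve-∀
  last : term s c (suc n) (suc n) ≡ term s c′ (suc n) (suc n)
  last rewrite ℕ.n∸n≡0 n = refl

-- Cancelling the factors 1 - λ one at a time leaves the constant series 1, which is the series of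
-- `#compositions 0`.
term-sum : ∀ s n → sumℤ≤ n (term s (#compositions s) n) ≡ + #compositions 0 n
term-sum (suc s) n       = trans (term-sum-step s n) (term-sum s n)
term-sum zero    zero    = refl
term-sum zero    (suc n) = trans (sumℤ≤-first n _) (cong (ℤ._+_ (+ 0)) (sumℤ≤-zero n λ k _ →
  trans (cong (ℤ._* + #compositions 0 (n ∸ k)) (ℤ.*-zeroʳ (- sgn k))) (ℤ.*-zeroˡ (+ #compositions 0 (n ∸ k)))))

-- The sign function local to seriesCoeff has no name outside Defs.  It is recovered by unification,
-- which succeeds once the non-injective functions in the definition of ℤ._*_ are abstracted.
seriesCoeff-sign : ∀ e c n → Σ (ℕ → ℤ) λ σ →
  seriesCoeff e c n ≡ sumℤ≤ n (λ k → σ k ℤ.* + (suc e C k) ℤ.* + c (n ∸ k))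
seriesCoeff-sign e c n with ℤ._◃_ | Sign._*_ | ℤ.sign
... | _ | _ | _ = _ , refl

seriesCoeff-term : ∀ e c n → seriesCoeff e c n ≡ sumℤ≤ n (term (suc e) c n)
seriesCoeff-term e c n = trans (proj₂ (seriesCoeff-sign e c n))
  (sumℤ≤-cong n λ k _ → cong (λ x → x ℤ.* + (suc e C k) ℤ.* + c (n ∸ k)) (σ≡sgn k))
  where
  σ≡sgn : ∀ k → proj₁ (seriesCoeff-sign e c n) k ≡ sgn k
  σ≡sgn zero    = refl
  σ≡sgn (suc k) = cong -_ (σ≡sgn k)

-- The Ehrhart series is (1 - λ)^(-(e+1)), so the δ-vector is (1, 0, ..., 0).
unimodular⇒normVol : ∀ {d m} {V : Fin m → Point d} {S e} → Unimodular V S → ∣ S ∣ ≡ suc e → NormVol V S e (+ 1)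
unimodular⇒normVol {V = V} {S} {e} dual ∣S∣ =
  #compositions (suc e) , c0 (suc e) ,
  (λ n 1≤n → subst (λ s → HasCount (InDilate V S n) (#compositions s n)) ∣S∣ (lattice-point-count {V = V} {S} dual n 1≤n)) ,
  (λ { (suc n) _ → coeff (suc n) }) ,
  total e
  where
  c0 : ∀ s → #compositions s 0 ≡ 1
  c0 zero    = refl
  c0 (suc s) = c0 s
  coeff : ∀ n → seriesCoeff e (#compositions (suc e)) n ≡ + #compositions 0 n
  coeff n = trans (seriesCoeff-term e (#compositions (suc e)) n) (term-sum (suc e) n)
  total : ∀ n → sumℤ≤ n (seriesCoeff e (#compositions (suc e))) ≡ + 1
  total zero    = coeff 0
  total (suc n) = cong₂ ℤ._+_ (total n) (coeff (suc n))

-- The polytope and its affine functions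

δ : ∀ {n} → Fin n → Fin n → ℤ
δ x y with x Fin.≟ y
... | yes _ = + 1
... | no _  = + 0

δ-refl : ∀ {n} (x : Fin n) → δ x x ≡ + 1
δ-refl x with x Fin.≟ x
... | yes _  = refl
... | no x≢x = contradiction refl x≢x

δ-≢ : ∀ {n} {x y : Fin n} → y ≢ x → δ x y ≡ + 0
δ-≢ {x = x} {y} y≢x with x Fin.≟ y
... | yes x≡y = contradiction (≡.sym x≡y) y≢x
... | no _    = refl

unitPoint : ∀ {n} → Fin n → Point (suc n)
unitPoint x = + 0 ∷ tabulate (δ x)

curvePoint : ∀ n → ℕ → Point (suc n)
curvePoint n s = + s ∷ replicate n (+ (s ℕ.* s))

-- With the unit points listed first, a vertex set has the form `A ++ᵛ B`, where `A` selects unit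
-- points and `B` selects curve points. The `suc k` curve points have parameters 0, ..., k, so `k`
-- stands for h₁.
vertices : ∀ n k → Fin (n ℕ.+ suc k) → Point (suc n)
vertices n k j = [ unitPoint , (λ s → curvePoint n (toℕ s)) ]′ (Fin.splitAt n j)

vertices-unit : ∀ {n k} (x : Fin n) → vertices n k (x ↑ˡ suc k) ≡ unitPoint x
vertices-unit {n} {k} x rewrite Fin.splitAt-↑ˡ n x (suc k) = refl

vertices-curve : ∀ {n k} (s : Fin (suc k)) → vertices n k (n ↑ʳ s) ≡ curvePoint n (toℕ s)
vertices-curve {n} {k} s rewrite Fin.splitAt-↑ʳ n (suc k) s = refl

eval-unit : ∀ {n k} (a : Fin (suc n) → ℚ) (x : Fin n) → eval (vertices n k) a (x ↑ˡ suc k) ≡ a (suc x)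
eval-unit {n} {k} a x rewrite vertices-unit {n} {k} x = begin
  a zero ℚ.* 0ℚ ℚ.+ sumℚ n (λ y → a (suc y) ℚ.* toℚ (lookup (tabulate (δ x)) y))
    ≡⟨ cong₂ ℚ._+_ (ℚ.*-zeroʳ (a zero)) (sum-cong n (λ y → cong (λ z → a (suc y) ℚ.* toℚ z) (Vec.lookup∘tabulate (δ x) y))) ⟩
  0ℚ ℚ.+ sumℚ n (λ y → a (suc y) ℚ.* toℚ (δ x y))
    ≡⟨ ℚ.+-identityˡ _ ⟩
  sumℚ n (λ y → a (suc y) ℚ.* toℚ (δ x y))
    ≡⟨ sum-single n _ x (λ y y≢x → trans (cong (λ z → a (suc y) ℚ.* toℚ z) (δ-≢ y≢x)) (ℚ.*-zeroʳ (a (suc y)))) ⟩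
  a (suc x) ℚ.* toℚ (δ x x)
    ≡⟨ trans (cong (λ z → a (suc x) ℚ.* toℚ z) (δ-refl x)) (ℚ.*-identityʳ (a (suc x))) ⟩
  a (suc x) ∎
  where open ≡-Reasoning

eval-curve : ∀ {n k} (a : Fin (suc n) → ℚ) (s : Fin (suc k)) →
  let t = toℚ (+ toℕ s) in
  eval (vertices n k) a (n ↑ʳ s) ≡ sumℚ n (λ x → a (suc x)) ℚ.* (t ℚ.* t) ℚ.+ a zero ℚ.* t
eval-curve {n} {k} a s rewrite vertices-curve {n} {k} s = begin
  a zero ℚ.* t ℚ.+ sumℚ n (λ x → a (suc x) ℚ.* toℚ (lookup (replicate n (+ (toℕ s ℕ.* toℕ s))) x))
    ≡⟨ cong (a zero ℚ.* t ℚ.+_) (sum-cong n (λ x → cong (a (suc x) ℚ.*_)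
         (trans (cong toℚ (trans (Vec.lookup-replicate x (+ (toℕ s ℕ.* toℕ s))) (ℤ.pos-* (toℕ s) (toℕ s))))
                (toℚ-* (+ toℕ s) (+ toℕ s))))) ⟩
  a zero ℚ.* t ℚ.+ sumℚ n (λ x → a (suc x) ℚ.* (t ℚ.* t))
    ≡⟨ cong (a zero ℚ.* t ℚ.+_) (sum-*ʳ n (t ℚ.* t) (λ x → a (suc x))) ⟩
  a zero ℚ.* t ℚ.+ sumℚ n (λ x → a (suc x)) ℚ.* (t ℚ.* t)
    ≡⟨ ℚ.+-comm (a zero ℚ.* t) (sumℚ n (λ x → a (suc x)) ℚ.* (t ℚ.* t)) ⟩
  _ ∎
  where
  open ≡-Reasoning
  t = toℚ (+ toℕ s)

vertex-cases : ∀ {n k} {P : Fin (n ℕ.+ k) → Set} → (∀ x → P (x ↑ˡ k)) → (∀ s → P (n ↑ʳ s)) → ∀ j → P j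
vertex-cases {n} {k} {P} p q j with Fin.splitAt n j | Fin.join-splitAt n k j
... | inj₁ x | refl = p x
... | inj₂ s | refl = q s

-- The affine function with constant term γ that takes the value u x at the unit point x and has
-- slope β in coordinate zero.
coeffs : ∀ {n} → (Fin n → ℤ) → ℤ → ℤ → Fin (suc n) → ℤ
coeffs u β γ zero    = β
coeffs u β γ (suc x) = u x ℤ.- γ

curveValue : ∀ n → (Fin n → ℤ) → ℤ → ℤ → ℤ → ℤ
curveValue n u β γ s = (sumℤ n u ℤ.- + n ℤ.* γ) ℤ.* (s ℤ.* s) ℤ.+ β ℤ.* s ℤ.+ γ

affine-unit : ∀ {n k} u β γ (x : Fin n) → affine (vertices n k) (coeffs u β γ) γ (x ↑ˡ suc k) ≡ toℚ (u x)
affine-unit {n} {k} u β γ x = trans (cong (ℚ._+ toℚ γ) (eval-unit {n} {k} (toℚ ∘ coeffs u β γ) x))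
  (trans (≡.sym (toℚ-+ (u x ℤ.- γ) γ)) (cong toℚ (lemma (u x) γ)))
  where
  lemma : ∀ a b → a ℤ.- b ℤ.+ b ≡ a
  lemma = solve-∀

affine-curve : ∀ {n k} u β γ (s : Fin (suc k)) →
  affine (vertices n k) (coeffs u β γ) γ (n ↑ʳ s) ≡ toℚ (curveValue n u β γ (+ toℕ s))
affine-curve {n} {k} u β γ s = begin
  eval (vertices n k) (toℚ ∘ coeffs u β γ) (n ↑ʳ s) ℚ.+ toℚ γ
    ≡⟨ cong (ℚ._+ toℚ γ) (eval-curve {n} {k} (toℚ ∘ coeffs u β γ) s) ⟩
  sumℚ n (λ x → toℚ (u x ℤ.- γ)) ℚ.* (toℚ t ℚ.* toℚ t) ℚ.+ toℚ β ℚ.* toℚ t ℚ.+ toℚ γ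
    ≡⟨ cong₂ (λ p q → p ℚ.+ q ℚ.+ toℚ γ) (cong₂ ℚ._*_ sum-u (≡.sym (toℚ-* t t))) (≡.sym (toℚ-* β t)) ⟩
  toℚ (sumℤ n u ℤ.- + n ℤ.* γ) ℚ.* toℚ (t ℤ.* t) ℚ.+ toℚ (β ℤ.* t) ℚ.+ toℚ γ
    ≡⟨ cong (λ p → p ℚ.+ toℚ (β ℤ.* t) ℚ.+ toℚ γ) (toℚ-* (sumℤ n u ℤ.- + n ℤ.* γ) (t ℤ.* t)) ⟨
  toℚ ((sumℤ n u ℤ.- + n ℤ.* γ) ℤ.* (t ℤ.* t)) ℚ.+ toℚ (β ℤ.* t) ℚ.+ toℚ γ
    ≡⟨ cong (ℚ._+ toℚ γ) (toℚ-+ ((sumℤ n u ℤ.- + n ℤ.* γ) ℤ.* (t ℤ.* t)) (β ℤ.* t)) ⟨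
  toℚ ((sumℤ n u ℤ.- + n ℤ.* γ) ℤ.* (t ℤ.* t) ℤ.+ β ℤ.* t) ℚ.+ toℚ γ
    ≡⟨ toℚ-+ ((sumℤ n u ℤ.- + n ℤ.* γ) ℤ.* (t ℤ.* t) ℤ.+ β ℤ.* t) γ ⟨
  _ ∎
  where
  open ≡-Reasoning
  t = + toℕ s
  sum-u : sumℚ n (λ x → toℚ (u x ℤ.- γ)) ≡ toℚ (sumℤ n u ℤ.- + n ℤ.* γ)
  sum-u = begin
    sumℚ n (λ x → toℚ (u x ℤ.- γ))
      ≡⟨ sum-cong n (λ x → toℚ-+ (u x) (- γ)) ⟩
    sumℚ n (λ x → toℚ (u x) ℚ.+ toℚ (- γ))
      ≡⟨ trans (sum-+ n (toℚ ∘ u) (λ _ → toℚ (- γ))) (cong₂ ℚ._+_ (≡.sym (toℚ-sum n u)) (sum-const n (toℚ (- γ)))) ⟩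
    toℚ (sumℤ n u) ℚ.+ toℚ (+ n) ℚ.* toℚ (- γ)
      ≡⟨ cong (toℚ (sumℤ n u) ℚ.+_) (toℚ-* (+ n) (- γ)) ⟨
    toℚ (sumℤ n u) ℚ.+ toℚ (+ n ℤ.* - γ)
      ≡⟨ toℚ-+ (sumℤ n u) (+ n ℤ.* - γ) ⟨
    toℚ (sumℤ n u ℤ.+ + n ℤ.* - γ)
      ≡⟨ cong (λ z → toℚ (sumℤ n u ℤ.+ z)) (≡.sym (ℤ.neg-distribʳ-* (+ n) γ)) ⟩
    toℚ (sumℤ n u ℤ.- + n ℤ.* γ) ∎

-- A face is handled as the zero set of a nonnegative integral affine function. Negating the linear
-- part and keeping the constant term gives the form a·x ≤ b.
isFace⁺ : ∀ {d m} (V : Fin m → Point d) F a b →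
  (∀ j → 0ℚ ℚ.≤ affine V a b j) → (∀ j → lookup F j ≡ true ⇔ affine V a b j ≡ 0ℚ) → IsFace V F
isFace⁺ {d} V F a b nonneg zeros =
  (λ i → ℚ.- toℚ (a i)) , toℚ b ,
  (λ j → subst₂ ℚ._≤_ (trans (ℚ.+-identityˡ _) (≡.sym (eval-neg j))) (cancel (eval V (toℚ ∘ a) j) (toℚ b))
    (ℚ.+-monoˡ-≤ (ℚ.- eval V (toℚ ∘ a) j) (nonneg j))) ,
  (λ j → mk⇔
    (λ e → trans (eval-neg j) (trans (expand₁ (eval V (toℚ ∘ a) j) (toℚ b))
      (trans (cong (λ z → toℚ b ℚ.- z) (Equivalence.to (zeros j) e)) (ℚ.+-identityʳ (toℚ b)))))
    (λ e → Equivalence.from (zeros j) (trans (cong (eval V (toℚ ∘ a) j ℚ.+_) (trans (≡.sym e) (eval-neg j)))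
      (ℚ.+-inverseʳ (eval V (toℚ ∘ a) j)))))
  where
  open +-*-Solver
  neg-* : ∀ p q → (ℚ.- p) ℚ.* q ≡ ℚ.- 1ℚ ℚ.* (p ℚ.* q)
  neg-* = solve 2 (λ p q → (:- p) :* q := con (ℚ.- 1ℚ) :* (p :* q)) refl
  neg-1 : ∀ p → ℚ.- 1ℚ ℚ.* p ≡ ℚ.- p
  neg-1 = solve 1 (λ p → con (ℚ.- 1ℚ) :* p := :- p) refl
  cancel : ∀ p q → p ℚ.+ q ℚ.+ (ℚ.- p) ≡ q
  cancel = solve 2 (λ p q → p :+ q :+ (:- p) := q) refl
  expand₁ : ∀ p q → ℚ.- p ≡ q ℚ.- (p ℚ.+ q)
  expand₁ = solve 2 (λ p q → :- p := q :- (p :+ q)) refl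
  eval-neg : ∀ j → eval V (λ i → ℚ.- toℚ (a i)) j ≡ ℚ.- eval V (toℚ ∘ a) j
  eval-neg j = trans (sum-cong d (λ i → neg-* (toℚ (a i)) (coord (V j) i)))
    (trans (sum-*ˡ d (ℚ.- 1ℚ) _) (neg-1 (eval V (toℚ ∘ a) j)))

module _ {n k : ℕ} {A : Subset n} {B : Subset (suc k)} where

  -- The values `u`, the slope `β` and the constant `γ` can be prescribed independently, so finding
  -- a supporting hyperplane reduces to conditions on `u` and on one quadratic in s.
  polytope-isFace⁺ : ∀ u β γ →
    (∀ x → + 0 ℤ.≤ u x) → (∀ x → lookup A x ≡ true ⇔ u x ≡ + 0) →
    (∀ s → + 0 ℤ.≤ curveValue n u β γ (+ toℕ s)) →
    (∀ s → lookup B s ≡ true ⇔ curveValue n u β γ (+ toℕ s) ≡ + 0) →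
    IsFace (vertices n k) (A ++ᵛ B)
  polytope-isFace⁺ u β γ u≥0 zeros-u v≥0 zeros-v = isFace⁺ (vertices n k) (A ++ᵛ B) (coeffs u β γ) γ
    (vertex-cases {n} {suc k}
      (λ x → subst (0ℚ ℚ.≤_) (≡.sym (affine-unit {n} {k} u β γ x)) (toℚ-mono {+ 0} {u x} (u≥0 x)))
      (λ s → subst (0ℚ ℚ.≤_) (≡.sym (affine-curve {n} {k} u β γ s)) (toℚ-mono {+ 0} {curveValue n u β γ (+ toℕ s)} (v≥0 s))))
    (vertex-cases {n} {suc k}
      (λ x → zero-iff (affine-unit {n} {k} u β γ x) (Vec.lookup-++ˡ A B x) (zeros-u x))
      (λ s → zero-iff (affine-curve {n} {k} u β γ s) (Vec.lookup-++ʳ A B s) (zeros-v s)))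
    where
    zero-iff : ∀ {p z b c} → p ≡ toℚ z → b ≡ c → c ≡ true ⇔ z ≡ + 0 → b ≡ true ⇔ p ≡ 0ℚ
    zero-iff refl refl e = mk⇔ (cong toℚ ∘ Equivalence.to e) (Equivalence.from e ∘ toℚ-injective)

  polytope-unimodular⁺ :
    (∀ x → lookup A x ≡ true → Σ (Fin n → ℤ) λ u → Σ ℤ λ β → Σ ℤ λ γ →
      u x ≡ + 1 × (∀ y → lookup A y ≡ true → y ≢ x → u y ≡ + 0) ×
      (∀ s → lookup B s ≡ true → curveValue n u β γ (+ toℕ s) ≡ + 0)) →
    (∀ s → lookup B s ≡ true → Σ (Fin n → ℤ) λ u → Σ ℤ λ β → Σ ℤ λ γ →
      curveValue n u β γ (+ toℕ s) ≡ + 1 × (∀ x → lookup A x ≡ true → u x ≡ + 0) ×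
      (∀ t → lookup B t ≡ true → t ≢ s → curveValue n u β γ (+ toℕ t) ≡ + 0)) →
    Unimodular (vertices n k) (A ++ᵛ B)
  polytope-unimodular⁺ unit curve = vertex-cases {n} {suc k}
    (λ x x∈ → let u , β , γ , one , zero-u , zero-v = unit x (trans (≡.sym (Vec.lookup-++ˡ A B x)) x∈) in
      coeffs u β γ , γ , trans (affine-unit {n} {k} u β γ x) (cong toℚ one) ,
      vertex-cases {n} {suc k}
        (λ y y∈ y≢x → trans (affine-unit {n} {k} u β γ y)
          (cong toℚ (zero-u y (trans (≡.sym (Vec.lookup-++ˡ A B y)) y∈) (y≢x ∘ cong (_↑ˡ suc k)))))
        (λ s s∈ _ → trans (affine-curve {n} {k} u β γ s)
          (cong toℚ (zero-v s (trans (≡.sym (Vec.lookup-++ʳ A B s)) s∈)))))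
    (λ s s∈ → let u , β , γ , one , zero-u , zero-v = curve s (trans (≡.sym (Vec.lookup-++ʳ A B s)) s∈) in
      coeffs u β γ , γ , trans (affine-curve {n} {k} u β γ s) (cong toℚ one) ,
      vertex-cases {n} {suc k}
        (λ x x∈ _ → trans (affine-unit {n} {k} u β γ x)
          (cong toℚ (zero-u x (trans (≡.sym (Vec.lookup-++ˡ A B x)) x∈))))
        (λ t t∈ t≢s → trans (affine-curve {n} {k} u β γ t)
          (cong toℚ (zero-v t (trans (≡.sym (Vec.lookup-++ʳ A B t)) t∈) (t≢s ∘ cong (n ↑ʳ_))))))

-- The face lattice

-- The edge joining i and i + 1 in the path 0, 1, ..., m.
pair : ∀ {m} → Fin m → Subset (suc m)
pair zero    = true ∷ true ∷ ⊥
pair (suc i) = false ∷ pair i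

lookup-⊥ : ∀ {m} (s : Fin m) → lookup ⊥ s ≡ false
lookup-⊥ s = Vec.lookup-replicate s false

lookup-⊤ : ∀ {m} (s : Fin m) → lookup ⊤ s ≡ true
lookup-⊤ s = Vec.lookup-replicate s true

≢true⇒false : ∀ {b} → b ≢ true → b ≡ false
≢true⇒false {false} _ = refl
≢true⇒false {true}  p = contradiction refl p

∉⊥ : ∀ {m} (s : Fin m) → lookup ⊥ s ≢ true
∉⊥ s e with trans (≡.sym (lookup-⊥ s)) e
... | ()

⁅⁆⁻ : ∀ {m} (i s : Fin m) → lookup ⁅ i ⁆ s ≡ true → s ≡ i
⁅⁆⁻ i s e = Subset.x∈⁅y⁆⇒x≡y i (Vec.lookup⇒[]= s ⁅ i ⁆ e)

⁅⁆⁺ : ∀ {m} (i : Fin m) → lookup ⁅ i ⁆ i ≡ true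
⁅⁆⁺ i = Vec.[]=⇒lookup (Subset.x∈⁅x⁆ i)

pair⁻ : ∀ {m} (i : Fin m) s → lookup (pair i) s ≡ true → toℕ s ≡ toℕ i ⊎ toℕ s ≡ suc (toℕ i)
pair⁻ zero    zero          _ = inj₁ refl
pair⁻ zero    (suc zero)    _ = inj₂ refl
pair⁻ zero    (suc (suc s)) e = contradiction e (∉⊥ s)
pair⁻ (suc i) (suc s)       e with pair⁻ i s e
... | inj₁ p = inj₁ (cong suc p)
... | inj₂ p = inj₂ (cong suc p)

pair⁺ : ∀ {m} (i : Fin m) s → toℕ s ≡ toℕ i ⊎ toℕ s ≡ suc (toℕ i) → lookup (pair i) s ≡ true
pair⁺ zero    zero          _ = refl
pair⁺ zero    (suc zero)    _ = refl
pair⁺ zero    (suc (suc s)) (inj₁ ())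
pair⁺ zero    (suc (suc s)) (inj₂ ())
pair⁺ (suc i) zero          (inj₁ ())
pair⁺ (suc i) zero          (inj₂ ())
pair⁺ (suc i) (suc s)       (inj₁ e) = pair⁺ i s (inj₁ (ℕ.suc-injective e))
pair⁺ (suc i) (suc s)       (inj₂ e) = pair⁺ i s (inj₂ (ℕ.suc-injective e))

data Path : ∀ {m} → Subset m → Set where
  none : ∀ {m} → Path (⊥ {m})
  one  : ∀ {m} (i : Fin m) → Path ⁅ i ⁆
  two  : ∀ {m} (i : Fin m) → Path (pair i)

data End {k} : Subset (suc k) → Set where
  none  : End ⊥
  first : End ⁅ zero ⁆
  last  : End ⁅ fromℕ k ⁆

-- If Δ is the simplex on the unit points and Γ the path on the curve points, this is the boundary
-- of the join Δ * Γ, namely the union of ∂Δ * Γ (`side`) and Δ * ∂Γ (`end`).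
data Face {n k} : Subset (n ℕ.+ suc k) → Set where
  side : ∀ {A : Subset n} {B : Subset (suc k)} x → lookup A x ≡ false → Path B → Face (A ++ᵛ B)
  end  : ∀ {B : Subset (suc k)} → End B → Face (⊤ {n} ++ᵛ B)

-- The constant `q₀` is natural so that 1 + n q₀, the value given in `side-isFace` to the missing
-- unit points, is positive.
record Parabola {m} (B : Subset m) : Set where
  field
    q₁     : ℤ
    q₀     : ℕ
  value : ℤ → ℤ
  value s = s ℤ.* s ℤ.+ q₁ ℤ.* s ℤ.+ + q₀
  field
    nonneg : ∀ (s : Fin m) → + 0 ℤ.≤ value (+ toℕ s)
    zeros  : ∀ s → lookup B s ≡ true ⇔ value (+ toℕ s) ≡ + 0

square-nonneg : ∀ z → + 0 ℤ.≤ z ℤ.* z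
square-nonneg (+ zero)  = ℤ.+≤+ z≤n
square-nonneg (+ suc _) = ℤ.+≤+ z≤n
square-nonneg -[1+ _ ]  = ℤ.+≤+ z≤n

-- This is special to integers: over the reals the product is negative strictly between 0 and 1. It
-- is the reason why two consecutive curve points can span an edge.
pronic-nonneg : ∀ z → + 0 ℤ.≤ z ℤ.* (z ℤ.- + 1)
pronic-nonneg (+ zero)        = ℤ.+≤+ z≤n
pronic-nonneg (+ suc zero)    = ℤ.+≤+ z≤n
pronic-nonneg (+ suc (suc _)) = ℤ.+≤+ z≤n
pronic-nonneg -[1+ _ ]        = ℤ.+≤+ z≤n

path⇒parabola : ∀ {m} {B : Subset m} → Path B → Parabola B
path⇒parabola none = record
  { q₁ = + 0 ; q₀ = 1
  ; nonneg = λ s → subst (+ 0 ℤ.≤_) (≡.sym (eq s)) (ℤ.+≤+ z≤n)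
  ; zeros  = λ s → mk⇔ (λ e → contradiction e (∉⊥ s)) (λ e → contradiction (trans (≡.sym e) (eq s)) λ ())
  }
  where
  lemma : ∀ s → s ℤ.* s ℤ.+ + 0 ℤ.* s ℤ.+ + 1 ≡ + 1 ℤ.+ s ℤ.* s
  lemma = solve-∀
  eq : ∀ s → _ ≡ + suc (toℕ s ℕ.* toℕ s)
  eq s = trans (lemma (+ toℕ s)) (cong (ℤ._+_ (+ 1)) (≡.sym (ℤ.pos-* (toℕ s) (toℕ s))))
path⇒parabola (one i) = record
  { q₁ = - (+ 2 ℤ.* + toℕ i) ; q₀ = toℕ i ℕ.* toℕ i
  ; nonneg = λ s → subst (+ 0 ℤ.≤_) (≡.sym (eq s)) (square-nonneg (+ toℕ s ℤ.- + toℕ i))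
  ; zeros  = λ s → mk⇔
      (λ e → trans (eq s) (cong (λ z → z ℤ.* z) (ℤ.i≡j⇒i-j≡0 {+ toℕ s} {+ toℕ i} (cong (+_ ∘ toℕ) (⁅⁆⁻ i s e)))))
      (λ e → root s (ℤ.i*j≡0⇒i≡0∨j≡0 (+ toℕ s ℤ.- + toℕ i) (trans (≡.sym (eq s)) e)))
  }
  where
  lemma : ∀ s i → s ℤ.* s ℤ.+ - (+ 2 ℤ.* i) ℤ.* s ℤ.+ i ℤ.* i ≡ (s ℤ.- i) ℤ.* (s ℤ.- i)
  lemma = solve-∀
  eq : ∀ s → _ ≡ (+ toℕ s ℤ.- + toℕ i) ℤ.* (+ toℕ s ℤ.- + toℕ i)
  eq s = trans (cong (ℤ._+_ (+ toℕ s ℤ.* + toℕ s ℤ.+ - (+ 2 ℤ.* + toℕ i) ℤ.* + toℕ s)) (ℤ.pos-* (toℕ i) (toℕ i)))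
    (lemma (+ toℕ s) (+ toℕ i))
  root′ : ∀ s → + toℕ s ℤ.- + toℕ i ≡ + 0 → lookup ⁅ i ⁆ s ≡ true
  root′ s e = subst (λ s → lookup ⁅ i ⁆ s ≡ true)
    (≡.sym (Fin.toℕ-injective (ℤ.+-injective (ℤ.i-j≡0⇒i≡j (+ toℕ s) (+ toℕ i) e)))) (⁅⁆⁺ i)
  root : ∀ s → _ ⊎ _ → lookup ⁅ i ⁆ s ≡ true
  root s (inj₁ e) = root′ s e
  root s (inj₂ e) = root′ s e
path⇒parabola (two i) = record
  { q₁ = - (+ 2 ℤ.* + toℕ i ℤ.+ + 1) ; q₀ = toℕ i ℕ.* suc (toℕ i)
  ; nonneg = λ s → subst (+ 0 ℤ.≤_) (≡.sym (eq s)) (pronic-nonneg (+ toℕ s ℤ.- + toℕ i))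
  ; zeros  = λ s → mk⇔
      (λ e → trans (eq s) (vanish s (pair⁻ i s e)))
      (λ e → root s (ℤ.i*j≡0⇒i≡0∨j≡0 (+ toℕ s ℤ.- + toℕ i) (trans (≡.sym (eq s)) e)))
  }
  where
  Q : ∀ s → ℤ
  Q s = (+ toℕ s ℤ.- + toℕ i) ℤ.* (+ toℕ s ℤ.- + toℕ i ℤ.- + 1)
  lemma : ∀ s i → s ℤ.* s ℤ.+ - (+ 2 ℤ.* i ℤ.+ + 1) ℤ.* s ℤ.+ i ℤ.* (+ 1 ℤ.+ i) ≡ (s ℤ.- i) ℤ.* (s ℤ.- i ℤ.- + 1)
  lemma = solve-∀
  eq : ∀ s → _ ≡ Q s
  eq s = trans (cong (ℤ._+_ (+ toℕ s ℤ.* + toℕ s ℤ.+ - (+ 2 ℤ.* + toℕ i ℤ.+ + 1) ℤ.* + toℕ s)) (ℤ.pos-* (toℕ i) (suc (toℕ i))))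
    (lemma (+ toℕ s) (+ toℕ i))
  shift : ∀ a b → a ℤ.- b ℤ.- + 1 ≡ a ℤ.- (+ 1 ℤ.+ b)
  shift = solve-∀
  vanish : ∀ s → toℕ s ≡ toℕ i ⊎ toℕ s ≡ suc (toℕ i) → Q s ≡ + 0
  vanish s (inj₁ e) = trans (cong (ℤ._* (+ toℕ s ℤ.- + toℕ i ℤ.- + 1)) (ℤ.i≡j⇒i-j≡0 {+ toℕ s} {+ toℕ i} (cong +_ e)))
    (ℤ.*-zeroˡ (+ toℕ s ℤ.- + toℕ i ℤ.- + 1))
  vanish s (inj₂ e) = trans (cong ((+ toℕ s ℤ.- + toℕ i) ℤ.*_)
    (trans (shift (+ toℕ s) (+ toℕ i)) (ℤ.i≡j⇒i-j≡0 {+ toℕ s} {+ suc (toℕ i)} (cong +_ e))))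
    (ℤ.*-zeroʳ (+ toℕ s ℤ.- + toℕ i))
  root : ∀ s → _ ⊎ _ → lookup (pair i) s ≡ true
  root s (inj₁ e) = pair⁺ i s (inj₁ (ℤ.+-injective (ℤ.i-j≡0⇒i≡j (+ toℕ s) (+ toℕ i) e)))
  root s (inj₂ e) = pair⁺ i s (inj₂ (ℤ.+-injective (ℤ.i-j≡0⇒i≡j (+ toℕ s) (+ suc (toℕ i))
    (trans (≡.sym (shift (+ toℕ s) (+ toℕ i))) e))))

outside : ∀ {n} → Subset n → ℤ → Fin n → ℤ
outside A z x with lookup A x
... | true  = + 0
... | false = z

sum-outside : ∀ {n} (A : Subset n) z → sumℤ n (outside A z) ≡ z ℤ.* + ∣ ∁ A ∣
sum-outside []          z = ≡.sym (ℤ.*-zeroʳ z)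
sum-outside (true ∷ A)  z = trans (ℤ.+-identityˡ (sumℤ _ (outside A z))) (sum-outside A z)
sum-outside (false ∷ A) z = trans (cong (ℤ._+_ z) (sum-outside A z)) (lemma z (+ ∣ ∁ A ∣))
  where
  lemma : ∀ a b → a ℤ.+ a ℤ.* b ≡ a ℤ.* (+ 1 ℤ.+ b)
  lemma = solve-∀

complement-nonempty : ∀ {n} (A : Subset n) x → lookup A x ≡ false → ∃ λ m → ∣ ∁ A ∣ ≡ suc m
complement-nonempty (false ∷ A) x       _ = ∣ ∁ A ∣ , refl
complement-nonempty (true ∷ A)  (suc x) e = complement-nonempty A x e

-- Let N > 0 be the number of missing unit points. Giving each the value 1 + n q₀, and taking γ = N
-- q₀, makes the leading coefficient N(1 + n q₀) - nN q₀ = N. The quadratic on the curve is thus N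
-- times the given monic one.
side-isFace : ∀ {n k} {A : Subset n} {B : Subset (suc k)} x → lookup A x ≡ false → Parabola B →
  IsFace (vertices n k) (A ++ᵛ B)
side-isFace {n} {k} {A} {B} x₀ x₀∉A P = polytope-isFace⁺ {n} {k} {A} {B} u (N ℤ.* q₁) (N ℤ.* + q₀)
  u≥0 zeros-u
  (λ s → subst (+ 0 ℤ.≤_) (≡.sym (value-eq (+ toℕ s)))
    (subst (ℤ._≤ N ℤ.* value (+ toℕ s)) (ℤ.*-zeroʳ N) (ℤ.*-monoˡ-≤-nonNeg N (nonneg s))))
  (λ s → mk⇔
    (λ e → trans (value-eq (+ toℕ s)) (trans (cong (N ℤ.*_) (Equivalence.to (zeros s) e)) (ℤ.*-zeroʳ N)))
    (λ e → Equivalence.from (zeros s) (cancel-N (ℤ.i*j≡0⇒i≡0∨j≡0 N (trans (≡.sym (value-eq (+ toℕ s))) e)))))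
  where
  open Parabola P
  N = + ∣ ∁ A ∣
  K = + suc (n ℕ.* q₀)
  u = outside A K
  u≥0 : ∀ x → + 0 ℤ.≤ u x
  u≥0 x with lookup A x
  ... | true  = ℤ.+≤+ z≤n
  ... | false = ℤ.+≤+ z≤n
  zeros-u : ∀ x → lookup A x ≡ true ⇔ u x ≡ + 0
  zeros-u x with lookup A x
  ... | true  = mk⇔ (λ _ → refl) (λ _ → refl)
  ... | false = mk⇔ (λ ()) (λ ())
  cancel-N : ∀ {z} → N ≡ + 0 ⊎ z ≡ + 0 → z ≡ + 0
  cancel-N (inj₂ e) = e
  cancel-N (inj₁ e) with trans (≡.sym (proj₂ (complement-nonempty A x₀ x₀∉A))) (ℤ.+-injective e)
  ... | ()
  lemma : ∀ n N a b s → ((+ 1 ℤ.+ n ℤ.* a) ℤ.* N ℤ.- n ℤ.* (N ℤ.* a)) ℤ.* (s ℤ.* s) ℤ.+ N ℤ.* b ℤ.* s ℤ.+ N ℤ.* a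
                       ≡ N ℤ.* (s ℤ.* s ℤ.+ b ℤ.* s ℤ.+ a)
  lemma = solve-∀
  value-eq : ∀ s → curveValue n u (N ℤ.* q₁) (N ℤ.* + q₀) s ≡ N ℤ.* value s
  value-eq s = trans
    (cong (λ z → (z ℤ.- + n ℤ.* (N ℤ.* + q₀)) ℤ.* (s ℤ.* s) ℤ.+ N ℤ.* q₁ ℤ.* s ℤ.+ N ℤ.* + q₀)
      (trans (sum-outside A K) (cong (λ z → (+ 1 ℤ.+ z) ℤ.* N) (ℤ.pos-* n q₀))))
    (lemma (+ n) N (+ q₀) q₁ s)

sumℤ-zero : ∀ n {f : Fin n → ℤ} → (∀ i → f i ≡ + 0) → sumℤ n f ≡ + 0
sumℤ-zero zero    eq = refl
sumℤ-zero (suc n) eq = cong₂ ℤ._+_ (eq zero) (sumℤ-zero n (λ i → eq (suc i)))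

curveValue-zero : ∀ n β γ s → curveValue n (λ _ → + 0) β γ s ≡ (+ 0 ℤ.- + n ℤ.* γ) ℤ.* (s ℤ.* s) ℤ.+ β ℤ.* s ℤ.+ γ
curveValue-zero n β γ s =
  cong (λ z → (z ℤ.- + n ℤ.* γ) ℤ.* (s ℤ.* s) ℤ.+ β ℤ.* s ℤ.+ γ) (sumℤ-zero n (λ _ → refl))

end-isFace⁺ : ∀ {n k} {B : Subset (suc k)} β γ (w : Fin (suc k) → ℕ) →
  (∀ s → curveValue n (λ _ → + 0) β γ (+ toℕ s) ≡ + w s) →
  (∀ s → lookup B s ≡ true ⇔ w s ≡ 0) → IsFace (vertices n k) (⊤ {n} ++ᵛ B)
end-isFace⁺ {n} {k} {B} β γ w value-eq zeros = polytope-isFace⁺ {n} {k} {⊤} {B} (λ _ → + 0) β γ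
  (λ _ → ℤ.+≤+ z≤n)
  (λ x → mk⇔ (λ _ → refl) (λ _ → lookup-⊤ x))
  (λ s → subst (+ 0 ℤ.≤_) (≡.sym (value-eq s)) (ℤ.+≤+ z≤n))
  (λ s → mk⇔ (λ e → trans (value-eq s) (cong +_ (Equivalence.to (zeros s) e)))
             (λ e → Equivalence.from (zeros s) (ℤ.+-injective (trans (≡.sym (value-eq s)) e))))

-- Substituting k = s + r turns identities with truncated subtraction into ring identities in s and
-- r.
+-split : ∀ {k} (s : Fin (suc k)) → + k ≡ + toℕ s ℤ.+ + (k ∸ toℕ s)
+-split {k} s = cong +_ (≡.sym (ℕ.m+[n∸m]≡n (Fin.toℕ≤pred[n] s)))

-- With all unit points on the hyperplane the quadratic is -nγs² + βs + γ. The pairs (γ, β) = (1,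
-- nk), (0, 1) and (k, nk² - 1) give 1 + ns(k - s), s and (k - s)(1 + nks), which are nonnegative
-- for 0 ≤ s ≤ k.
end-isFace : ∀ {n k} {B : Subset (suc k)} → End B → IsFace (vertices n k) (⊤ {n} ++ᵛ B)
end-isFace {n} {k} none = end-isFace⁺ {n} {k} {⊥} (+ n ℤ.* + k) (+ 1) (λ s → suc (n ℕ.* (toℕ s ℕ.* (k ∸ toℕ s))))
  (λ s → trans (curveValue-zero n (+ n ℤ.* + k) (+ 1) (+ toℕ s))
    (trans (lemma (+ k) (+ n) (+ toℕ s) (+ (k ∸ toℕ s)) (+-split s))
      (cong (ℤ._+_ (+ 1)) (≡.sym (trans (ℤ.pos-* n _) (cong (+ n ℤ.*_) (ℤ.pos-* (toℕ s) (k ∸ toℕ s))))))))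
  (λ s → mk⇔ (λ e → contradiction e (∉⊥ s)) (λ ()))
  where
  lemma′ : ∀ n s r → (+ 0 ℤ.- n ℤ.* + 1) ℤ.* (s ℤ.* s) ℤ.+ n ℤ.* (s ℤ.+ r) ℤ.* s ℤ.+ + 1 ≡ + 1 ℤ.+ n ℤ.* (s ℤ.* r)
  lemma′ = solve-∀
  lemma : ∀ k n s r → k ≡ s ℤ.+ r →
    (+ 0 ℤ.- n ℤ.* + 1) ℤ.* (s ℤ.* s) ℤ.+ n ℤ.* k ℤ.* s ℤ.+ + 1 ≡ + 1 ℤ.+ n ℤ.* (s ℤ.* r)
  lemma _ n s r refl = lemma′ n s r
end-isFace {n} {k} first = end-isFace⁺ {n} {k} {⁅ zero ⁆} (+ 1) (+ 0) toℕ
  (λ s → trans (curveValue-zero n (+ 1) (+ 0) (+ toℕ s)) (lemma (+ n) (+ toℕ s)))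
  (λ s → mk⇔ (cong toℕ ∘ ⁅⁆⁻ zero s) (λ e → subst (λ s → lookup ⁅ zero ⁆ s ≡ true) (≡.sym (Fin.toℕ-injective e)) refl))
  where
  lemma : ∀ n s → (+ 0 ℤ.- n ℤ.* + 0) ℤ.* (s ℤ.* s) ℤ.+ + 1 ℤ.* s ℤ.+ + 0 ≡ s
  lemma = solve-∀
end-isFace {n} {k} last = end-isFace⁺ {n} {k} {⁅ fromℕ k ⁆} β (+ k) (λ s → (k ∸ toℕ s) ℕ.* suc (n ℕ.* (k ℕ.* toℕ s)))
  (λ s → trans (curveValue-zero n β (+ k) (+ toℕ s))
    (trans (lemma (+ k) (+ n) (+ toℕ s) (+ (k ∸ toℕ s)) (+-split s))
      (≡.sym (trans (ℤ.pos-* (k ∸ toℕ s) _) (cong (λ z → + (k ∸ toℕ s) ℤ.* (+ 1 ℤ.+ z))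
        (trans (ℤ.pos-* n _) (cong (+ n ℤ.*_) (ℤ.pos-* k (toℕ s)))))))))
  (λ s → mk⇔
    (λ e → cong (ℕ._* suc (n ℕ.* (k ℕ.* toℕ s)))
      (trans (cong (λ s → k ∸ toℕ s) (⁅⁆⁻ (fromℕ k) s e)) (trans (cong (k ∸_) (Fin.toℕ-fromℕ k)) (ℕ.n∸n≡0 k))))
    (λ e → root s (ℕ.m*n≡0⇒m≡0∨n≡0 (k ∸ toℕ s) e)))
  where
  β = + n ℤ.* (+ k ℤ.* + k) ℤ.- + 1
  lemma′ : ∀ n s r → (+ 0 ℤ.- n ℤ.* (s ℤ.+ r)) ℤ.* (s ℤ.* s) ℤ.+ (n ℤ.* ((s ℤ.+ r) ℤ.* (s ℤ.+ r)) ℤ.- + 1) ℤ.* s ℤ.+ (s ℤ.+ r)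
    ≡ r ℤ.* (+ 1 ℤ.+ n ℤ.* ((s ℤ.+ r) ℤ.* s))
  lemma′ = solve-∀
  lemma : ∀ k n s r → k ≡ s ℤ.+ r →
    (+ 0 ℤ.- n ℤ.* k) ℤ.* (s ℤ.* s) ℤ.+ (n ℤ.* (k ℤ.* k) ℤ.- + 1) ℤ.* s ℤ.+ k ≡ r ℤ.* (+ 1 ℤ.+ n ℤ.* (k ℤ.* s))
  lemma _ n s r refl = lemma′ n s r
  root : ∀ s → k ∸ toℕ s ≡ 0 ⊎ suc (n ℕ.* (k ℕ.* toℕ s)) ≡ 0 → lookup ⁅ fromℕ k ⁆ s ≡ true
  root s (inj₁ e) = subst (λ s → lookup ⁅ fromℕ k ⁆ s ≡ true)
    (Fin.toℕ-injective (trans (Fin.toℕ-fromℕ k) (ℕ.≤-antisym (ℕ.m∸n≡0⇒m≤n e) (Fin.toℕ≤pred[n] s)))) (⁅⁆⁺ (fromℕ k))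
  root s (inj₂ ())

face⇒isFace : ∀ {n k} {S : Subset (n ℕ.+ suc k)} → Face S → IsFace (vertices n k) S
face⇒isFace {n} {k} (side {A} {B} x x∉ p) = side-isFace {n} {k} {A} {B} x x∉ (path⇒parabola p)
face⇒isFace {n} {k} (end e)       = end-isFace {n} {k} e

-- There are at least two curve points here, so a subset of ∂Γ of size at most one misses one of
-- them.
face⇒proper : ∀ {n k} {S : Subset (n ℕ.+ suc (suc k))} → Face {n} {suc k} S → S ≢ ⊤
face⇒proper {n} {k} (side {A} {B} x x∉A _) eq
  with trans (≡.sym x∉A) (trans (≡.sym (Vec.lookup-++ˡ A B x)) (trans (cong (λ S → lookup S (x ↑ˡ _)) eq) (lookup-⊤ (x ↑ˡ suc (suc k)))))
... | ()
face⇒proper {n} {k} (end {B} e) eq = missing e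
  (λ s → trans (≡.sym (Vec.lookup-++ʳ (⊤ {n}) B s)) (trans (cong (λ S → lookup S (n ↑ʳ s)) eq) (lookup-⊤ (n ↑ʳ s))))
  where
  missing : ∀ {B} → End B → ¬ (∀ s → lookup B s ≡ true)
  missing none  full = contradiction (full zero) λ ()
  missing first full = ∉⊥ {suc k} zero (full (suc zero))
  missing last  full = contradiction (full zero) λ ()

-- Unimodularity of the faces

sumℤ-single : ∀ n (f : Fin n → ℤ) i → (∀ j → j ≢ i → f j ≡ + 0) → sumℤ n f ≡ f i
sumℤ-single n f i eq = toℚ-injective (trans (toℚ-sum n f) (sum-single n (toℚ ∘ f) i (λ j j≢i → cong toℚ (eq j j≢i))))

sumℤ-+ : ∀ n (f g : Fin n → ℤ) → sumℤ n (λ i → f i ℤ.+ g i) ≡ sumℤ n f ℤ.+ sumℤ n g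
sumℤ-+ zero    f g = refl
sumℤ-+ (suc n) f g = trans (cong (ℤ._+_ (f zero ℤ.+ g zero)) (sumℤ-+ n (λ i → f (suc i)) (λ i → g (suc i))))
  (lemma (f zero) (g zero) (sumℤ n (λ i → f (suc i))) (sumℤ n (λ i → g (suc i))))
  where
  lemma : ∀ a b c d → (a ℤ.+ b) ℤ.+ (c ℤ.+ d) ≡ (a ℤ.+ c) ℤ.+ (b ℤ.+ d)
  lemma = solve-∀

sum-*δ : ∀ {n} c (x : Fin n) → sumℤ n (λ y → c ℤ.* δ x y) ≡ c
sum-*δ {n} c x = trans (sumℤ-single n (λ y → c ℤ.* δ x y) x (λ y y≢x → trans (cong (c ℤ.*_) (δ-≢ y≢x)) (ℤ.*-zeroʳ c)))
  (trans (cong (c ℤ.*_) (δ-refl x)) (ℤ.*-identityʳ c))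

curveValue-sum : ∀ n {u} U β γ s → sumℤ n u ≡ U →
  curveValue n u β γ s ≡ (U ℤ.- + n ℤ.* γ) ℤ.* (s ℤ.* s) ℤ.+ β ℤ.* s ℤ.+ γ
curveValue-sum n _ β γ s refl = refl

lookup-distinct : ∀ {n} {A : Subset n} {x y} → lookup A x ≡ true → lookup A y ≡ false → x ≢ y
lookup-distinct x∈ y∉ refl with trans (≡.sym x∈) y∉
... | ()

-- The missing point `x₀` may take any value. The dual of e_x is w_x - w_{x₀}, which vanishes on the
-- whole curve. For curve points, the value nγ at `x₀` removes the s² term, and the linear functions
-- i + 1 - s and s - i separate the two possible parameters.
side-unimodular : ∀ {n k} {A : Subset n} {B : Subset (suc k)} x₀ → lookup A x₀ ≡ false →
  ∀ i → (∀ s → lookup B s ≡ true → toℕ s ≡ i ⊎ toℕ s ≡ suc i) → Unimodular (vertices n k) (A ++ᵛ B)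
side-unimodular {n} {k} {A} {B} x₀ x₀∉A i within = polytope-unimodular⁺ {n} {k} {A} {B}
  (λ x x∈ → (λ y → + 1 ℤ.* δ x y ℤ.+ - + 1 ℤ.* δ x₀ y) , + 0 , + 0 ,
    cong₂ (λ a b → + 1 ℤ.* a ℤ.+ - + 1 ℤ.* b) (δ-refl x) (δ-≢ (lookup-distinct {A = A} x∈ x₀∉A)) ,
    (λ y y∈ y≢x → cong₂ (λ a b → + 1 ℤ.* a ℤ.+ - + 1 ℤ.* b) (δ-≢ y≢x) (δ-≢ (lookup-distinct {A = A} y∈ x₀∉A))) ,
    (λ s _ → trans (curveValue-sum n (+ 0) (+ 0) (+ 0) (+ toℕ s)
        (trans (sumℤ-+ n (λ y → + 1 ℤ.* δ x y) (λ y → - + 1 ℤ.* δ x₀ y)) (cong₂ ℤ._+_ (sum-*δ (+ 1) x) (sum-*δ (- + 1) x₀))))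
      (lemma₀ (+ n) (+ toℕ s))))
  curve
  where
  lemma₀ : ∀ n s → (+ 0 ℤ.- n ℤ.* + 0) ℤ.* (s ℤ.* s) ℤ.+ + 0 ℤ.* s ℤ.+ + 0 ≡ + 0
  lemma₀ = solve-∀
  -- This is the affine function β a + γ (1 - Σ w + n w_{x₀}).
  linear : ∀ β γ s → curveValue n (λ y → (+ n ℤ.* γ) ℤ.* δ x₀ y) β γ s ≡ β ℤ.* s ℤ.+ γ
  linear β γ s = trans (curveValue-sum n (+ n ℤ.* γ) β γ s (sum-*δ (+ n ℤ.* γ) x₀)) (lemma (+ n ℤ.* γ) β γ s)
    where
    lemma : ∀ m β γ s → (m ℤ.- m) ℤ.* (s ℤ.* s) ℤ.+ β ℤ.* s ℤ.+ γ ≡ β ℤ.* s ℤ.+ γ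
    lemma = solve-∀
  vanish : ∀ c x → lookup A x ≡ true → c ℤ.* δ x₀ x ≡ + 0
  vanish c x x∈ = trans (cong (c ℤ.*_) (δ-≢ (lookup-distinct {A = A} x∈ x₀∉A))) (ℤ.*-zeroʳ c)
  at-i at-suc : ℤ → ℤ
  at-i   s = - + 1 ℤ.* s ℤ.+ (+ 1 ℤ.+ + i)
  at-suc s = + 1 ℤ.* s ℤ.+ - + i
  at-i≡1 : ∀ i → - + 1 ℤ.* i ℤ.+ (+ 1 ℤ.+ i) ≡ + 1
  at-i≡1 = solve-∀
  at-i≡0 : ∀ i → - + 1 ℤ.* (+ 1 ℤ.+ i) ℤ.+ (+ 1 ℤ.+ i) ≡ + 0
  at-i≡0 = solve-∀
  at-suc≡1 : ∀ i → + 1 ℤ.* (+ 1 ℤ.+ i) ℤ.+ - i ≡ + 1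
  at-suc≡1 = solve-∀
  at-suc≡0 : ∀ i → + 1 ℤ.* i ℤ.+ - i ≡ + 0
  at-suc≡0 = solve-∀
  curve : ∀ s → lookup B s ≡ true → Σ (Fin n → ℤ) λ u → Σ ℤ λ β → Σ ℤ λ γ →
      curveValue n u β γ (+ toℕ s) ≡ + 1 × (∀ x → lookup A x ≡ true → u x ≡ + 0) ×
      (∀ t → lookup B t ≡ true → t ≢ s → curveValue n u β γ (+ toℕ t) ≡ + 0)
  curve s s∈ with within s s∈
  ... | inj₁ s≡i = _ , - + 1 , + 1 ℤ.+ + i ,
    trans (linear (- + 1) (+ 1 ℤ.+ + i) (+ toℕ s)) (trans (cong (at-i ∘ +_) s≡i) (at-i≡1 (+ i))) ,
    vanish (+ n ℤ.* (+ 1 ℤ.+ + i)) ,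
    (λ t t∈ t≢s → trans (linear (- + 1) (+ 1 ℤ.+ + i) (+ toℕ t)) (other t (within t t∈) t≢s))
    where
    other : ∀ t → toℕ t ≡ i ⊎ toℕ t ≡ suc i → t ≢ s → at-i (+ toℕ t) ≡ + 0
    other t (inj₁ t≡i) t≢s = contradiction (Fin.toℕ-injective (trans t≡i (≡.sym s≡i))) t≢s
    other t (inj₂ t≡)  t≢s = trans (cong (at-i ∘ +_) t≡) (at-i≡0 (+ i))
  ... | inj₂ s≡ = _ , + 1 , - + i ,
    trans (linear (+ 1) (- + i) (+ toℕ s)) (trans (cong (at-suc ∘ +_) s≡) (at-suc≡1 (+ i))) ,
    vanish (+ n ℤ.* - + i) ,
    (λ t t∈ t≢s → trans (linear (+ 1) (- + i) (+ toℕ t)) (other t (within t t∈) t≢s))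
    where
    other : ∀ t → toℕ t ≡ i ⊎ toℕ t ≡ suc i → t ≢ s → at-suc (+ toℕ t) ≡ + 0
    other t (inj₁ t≡i) t≢s = trans (cong (at-suc ∘ +_) t≡i) (at-suc≡0 (+ i))
    other t (inj₂ t≡)  t≢s = contradiction (Fin.toℕ-injective (trans t≡ (≡.sym s≡))) t≢s

-- The dual of e_x is w_x - pa. At v_s it takes the value s² - ps, so the number `p` only has to
-- satisfy s² = ps for the curve points present.
end-unimodular⁺ : ∀ {n k} {A : Subset n} {B : Subset (suc k)} p →
  (∀ s → lookup B s ≡ true → + toℕ s ℤ.* + toℕ s ≡ p ℤ.* + toℕ s) →
  (∀ s → lookup B s ≡ true → Σ ℤ λ β → Σ ℤ λ γ →
    curveValue n (λ _ → + 0) β γ (+ toℕ s) ≡ + 1 ×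
    (∀ t → lookup B t ≡ true → t ≢ s → curveValue n (λ _ → + 0) β γ (+ toℕ t) ≡ + 0)) →
  Unimodular (vertices n k) (A ++ᵛ B)
end-unimodular⁺ {n} {k} {A} {B} p root curve = polytope-unimodular⁺ {n} {k} {A} {B}
  (λ x _ → (λ y → + 1 ℤ.* δ x y) , - p , + 0 ,
    cong (+ 1 ℤ.*_) (δ-refl x) ,
    (λ y _ y≢x → cong (+ 1 ℤ.*_) (δ-≢ y≢x)) ,
    (λ s s∈ → trans (curveValue-sum n (+ 1) (- p) (+ 0) (+ toℕ s) (sum-*δ (+ 1) x))
      (trans (cong (λ z → (+ 1 ℤ.- + n ℤ.* + 0) ℤ.* z ℤ.+ - p ℤ.* + toℕ s ℤ.+ + 0) (root s s∈)) (lemma (+ n) p (+ toℕ s)))))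
  (λ s s∈ → let β , γ , v≡1 , v≡0 = curve s s∈ in (λ _ → + 0) , β , γ , v≡1 , (λ _ _ → refl) , v≡0)
  where
  lemma : ∀ n p s → (+ 1 ℤ.- n ℤ.* + 0) ℤ.* (p ℤ.* s) ℤ.+ - p ℤ.* s ℤ.+ + 0 ≡ + 0
  lemma = solve-∀

apex-unimodular : ∀ {n k} {A : Subset n} (i : Fin (suc k)) → Unimodular (vertices n k) (A ++ᵛ ⁅ i ⁆)
apex-unimodular {n} {k} {A} i = end-unimodular⁺ {n} {k} {A} {⁅ i ⁆} (+ toℕ i)
  (λ s s∈ → cong (λ j → + toℕ j ℤ.* + toℕ s) (⁅⁆⁻ i s s∈))
  -- This is the function 1 + nsa - Σ w. It vanishes at every e_x and equals 1 + ns² - ns² = 1 at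
  -- v_s.
  (λ s s∈ → + n ℤ.* + toℕ s , + 1 ,
    trans (curveValue-zero n (+ n ℤ.* + toℕ s) (+ 1) (+ toℕ s)) (lemma (+ n) (+ toℕ s)) ,
    (λ t t∈ t≢s → contradiction (trans (⁅⁆⁻ i t t∈) (≡.sym (⁅⁆⁻ i s s∈))) t≢s))
  where
  lemma : ∀ n s → (+ 0 ℤ.- n ℤ.* + 1) ℤ.* (s ℤ.* s) ℤ.+ n ℤ.* s ℤ.* s ℤ.+ + 1 ≡ + 1
  lemma = solve-∀

end-unimodular : ∀ {n k} {A : Subset n} {B : Subset (suc k)} → End B → Unimodular (vertices n k) (A ++ᵛ B)
end-unimodular {n} {k} {A} none  = end-unimodular⁺ {n} {k} {A} {⊥} (+ 0)
  (λ s s∈ → contradiction s∈ (∉⊥ s)) (λ s s∈ → contradiction s∈ (∉⊥ s))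
end-unimodular {n} {k} {A} first = apex-unimodular {n} {k} {A} zero
end-unimodular {n} {k} {A} last  = apex-unimodular {n} {k} {A} (fromℕ k)

path-within : ∀ {m} {B : Subset m} → Path B → ∃ λ i → ∀ s → lookup B s ≡ true → toℕ s ≡ i ⊎ toℕ s ≡ suc i
path-within none    = 0 , λ s s∈ → contradiction s∈ (∉⊥ s)
path-within (one i) = toℕ i , λ s s∈ → inj₁ (cong toℕ (⁅⁆⁻ i s s∈))
path-within (two i) = toℕ i , pair⁻ i

face⇒unimodular : ∀ {n k} {S : Subset (n ℕ.+ suc k)} → Face {n} {k} S → Unimodular (vertices n k) S
face⇒unimodular {n} {k} (side {A} {B} x x∉ p) = let i , within = path-within p in
  side-unimodular {n} {k} {A} {B} x x∉ i within
face⇒unimodular {n} {k} (end e) = end-unimodular {n} {k} {⊤} e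

∣++∣ : ∀ {m n} (A : Subset m) (B : Subset n) → ∣ A ++ᵛ B ∣ ≡ ∣ A ∣ ℕ.+ ∣ B ∣
∣++∣ []          B = refl
∣++∣ (true ∷ A)  B = cong suc (∣++∣ A B)
∣++∣ (false ∷ A) B = ∣++∣ A B

∣pair∣ : ∀ {m} (i : Fin m) → ∣ pair i ∣ ≡ 2
∣pair∣ {suc m} zero = cong (2 ℕ.+_) (Subset.∣⊥∣≡0 m)
∣pair∣ (suc i)      = ∣pair∣ i

-- The unit points with v₀ and v₁ form a unimodular simplex of dimension n + 1. Since s² = s for s =
-- 0, 1, p = 1 serves the unit points; the duals of v₀ and v₁ are 1 + (n - 1)a - Σ w and a.
fullDim : ∀ n k → FullDim (vertices n (suc k))
fullDim n k = ⊤ {n} ++ᵛ pair {suc k} zero ,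
  trans (∣++∣ (⊤ {n}) (pair {suc k} zero)) (trans (cong₂ ℕ._+_ (Subset.∣⊤∣≡n n) (∣pair∣ {suc k} zero)) (ℕ.+-comm n 2)) ,
  unimodular⇒affIndep {V = vertices n (suc k)} {⊤ {n} ++ᵛ pair {suc k} zero}
    (end-unimodular⁺ {n} {suc k} {⊤} {pair zero} (+ 1) root curve)
  where
  root : ∀ s → lookup (pair {suc k} zero) s ≡ true → + toℕ s ℤ.* + toℕ s ≡ + 1 ℤ.* + toℕ s
  root zero          _ = refl
  root (suc zero)    _ = refl
  root (suc (suc s)) e = contradiction e (∉⊥ s)
  curve : ∀ s → lookup (pair {suc k} zero) s ≡ true → Σ ℤ λ β → Σ ℤ λ γ →
    curveValue n (λ _ → + 0) β γ (+ toℕ s) ≡ + 1 ×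
    (∀ t → lookup (pair {suc k} zero) t ≡ true → t ≢ s → curveValue n (λ _ → + 0) β γ (+ toℕ t) ≡ + 0)
  curve (suc (suc s)) e = contradiction e (∉⊥ s)
  curve zero _ = + n ℤ.- + 1 , + 1 ,
    trans (curveValue-zero n (+ n ℤ.- + 1) (+ 1) (+ 0)) (lemma₀ (+ n)) ,
    λ { zero _ t≢s → contradiction refl t≢s
      ; (suc zero) _ _ → trans (curveValue-zero n (+ n ℤ.- + 1) (+ 1) (+ 1)) (lemma₁ (+ n))
      ; (suc (suc t)) e _ → contradiction e (∉⊥ t) }
    where
    lemma₀ : ∀ n → (+ 0 ℤ.- n ℤ.* + 1) ℤ.* (+ 0 ℤ.* + 0) ℤ.+ (n ℤ.- + 1) ℤ.* + 0 ℤ.+ + 1 ≡ + 1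
    lemma₀ = solve-∀
    lemma₁ : ∀ n → (+ 0 ℤ.- n ℤ.* + 1) ℤ.* (+ 1 ℤ.* + 1) ℤ.+ (n ℤ.- + 1) ℤ.* + 1 ℤ.+ + 1 ≡ + 0
    lemma₁ = solve-∀
  curve (suc zero) _ = + 1 , + 0 ,
    trans (curveValue-zero n (+ 1) (+ 0) (+ 1)) (lemma (+ n) (+ 1)) ,
    λ { zero _ _ → trans (curveValue-zero n (+ 1) (+ 0) (+ 0)) (lemma (+ n) (+ 0))
      ; (suc zero) _ t≢s → contradiction refl t≢s
      ; (suc (suc t)) e _ → contradiction e (∉⊥ t) }
    where
    lemma : ∀ n s → (+ 0 ℤ.- n ℤ.* + 0) ℤ.* (s ℤ.* s) ℤ.+ + 1 ℤ.* s ℤ.+ + 0 ≡ s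
    lemma = solve-∀

-- Radon relations and the classification of faces

toℚ-nonneg : ∀ m → 0ℚ ℚ.≤ toℚ (+ m)
toℚ-nonneg m = toℚ-mono {+ 0} {+ m} (ℤ.+≤+ z≤n)

*-nonneg : ∀ {p q} → 0ℚ ℚ.≤ p → 0ℚ ℚ.≤ q → 0ℚ ℚ.≤ p ℚ.* q
*-nonneg {p} {q} 0≤p 0≤q = subst (ℚ._≤ p ℚ.* q) (ℚ.*-zeroʳ p) (ℚ.*-monoˡ-≤-nonNeg p {{ℚ.nonNegative 0≤p}} 0≤q)

*-pos : ∀ {p q} → 0ℚ ℚ.< p → 0ℚ ℚ.< q → 0ℚ ℚ.< p ℚ.* q
*-pos {p} {q} 0<p 0<q = subst (ℚ._< p ℚ.* q) (ℚ.*-zeroʳ p) (ℚ.*-monoʳ-<-pos p {{ℚ.positive 0<p}} 0<q)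

1+-pos : ∀ {p} → 0ℚ ℚ.≤ p → 0ℚ ℚ.< 1ℚ ℚ.+ p
1+-pos 0≤p = ℚ.+-mono-<-≤ (ℚ.positive⁻¹ 1ℚ) 0≤p

pos*≡0⇒≡0 : ∀ {p q} → 0ℚ ℚ.< p → 0ℚ ℚ.≤ q → p ℚ.* q ≡ 0ℚ → q ≡ 0ℚ
pos*≡0⇒≡0 {p} {q} 0<p 0≤q eq = ℚ.≤-antisym
  (ℚ.*-cancelˡ-≤-pos p {{ℚ.positive 0<p}} (ℚ.≤-reflexive (trans eq (≡.sym (ℚ.*-zeroʳ p))))) 0≤q

module _ (N b A B : ℚ) (0≤N : 0ℚ ℚ.≤ N) where

  -- The slack of an inequality a·x ≤ b at the curve point of parameter t, where `A` is the sum of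
  -- the w-coefficients and `B` the coefficient of coordinate zero. Likewise `N ℚ.* b ℚ.- A` is the
  -- total slack at the unit points.
  slack : ℚ → ℚ
  slack t = b ℚ.- (A ℚ.* (t ℚ.* t) ℚ.+ B ℚ.* t)

  -- The Radon relation between two curve points and, on the other side, a curve point between
  -- them together with all unit points.
  record Circuit (i l j : ℚ) : Set where
    field
      {c₁ c₂ c₃ c₄} : ℚ
      c₁>0 : 0ℚ ℚ.< c₁
      c₂>0 : 0ℚ ℚ.< c₂
      c₃>0 : 0ℚ ℚ.< c₃
      c₄>0 : 0ℚ ℚ.< c₄
      relation : c₁ ℚ.* slack i ℚ.+ c₂ ℚ.* slack j ≡ c₃ ℚ.* slack l ℚ.+ c₄ ℚ.* (N ℚ.* b ℚ.- A)

  -- By Cramer's rule the weights are, up to sign, the 3×3 minors of the vectors (1, t, t²) for t =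
  -- i, l, j and (N, 0, 1): (j - l)(1 + Nlj), (l - i)(1 + Nil), (j - i)(1 + Nij) and (l - i)(j -
  -- i)(j - l). Writing the gaps as 1 + p and 1 + q makes them visibly positive.
  circuit : ∀ {i p q} → 0ℚ ℚ.≤ i → 0ℚ ℚ.≤ p → 0ℚ ℚ.≤ q →
    Circuit i (i ℚ.+ (1ℚ ℚ.+ p)) (i ℚ.+ (1ℚ ℚ.+ p) ℚ.+ (1ℚ ℚ.+ q))
  circuit {i} {p} {q} 0≤i 0≤p 0≤q = record
    { c₁>0 = *-pos q′ (1+-pos (*-nonneg 0≤N (*-nonneg 0≤l 0≤j)))
    ; c₂>0 = *-pos p′ (1+-pos (*-nonneg 0≤N (*-nonneg 0≤i 0≤l)))
    ; c₃>0 = *-pos pq′ (1+-pos (*-nonneg 0≤N (*-nonneg 0≤i 0≤j)))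
    ; c₄>0 = *-pos p′ (*-pos pq′ q′)
    ; relation = solve 7 (λ b A B N I P Q →
        let one = con 1ℚ
            L = I :+ (one :+ P)
            J = L :+ (one :+ Q)
            y = λ t → b :- (A :* (t :* t) :+ B :* t)
        in ((one :+ Q) :* (one :+ N :* (L :* J))) :* y I :+ ((one :+ P) :* (one :+ N :* (I :* L))) :* y J
           := ((one :+ P :+ (one :+ Q)) :* (one :+ N :* (I :* J))) :* y L
              :+ ((one :+ P) :* ((one :+ P :+ (one :+ Q)) :* (one :+ Q))) :* (N :* b :- A))
        refl b A B N i p q
    }
    where
    open +-*-Solver
    p′ = 1+-pos 0≤p
    q′ = 1+-pos 0≤q
    pq′ = ℚ.+-mono-< p′ q′
    0≤l = ℚ.+-mono-≤ 0≤i (ℚ.<⇒≤ p′)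
    0≤j = ℚ.+-mono-≤ 0≤l (ℚ.<⇒≤ q′)

  -- Each side of the relation is a positive combination of slacks. If one side is zero, the
  -- nonnegative slacks on the other side all vanish.
  outer⇒inner : ∀ {i l j} → Circuit i l j → 0ℚ ℚ.≤ slack l → 0ℚ ℚ.≤ N ℚ.* b ℚ.- A →
    slack i ≡ 0ℚ → slack j ≡ 0ℚ → slack l ≡ 0ℚ × N ℚ.* b ℚ.- A ≡ 0ℚ
  outer⇒inner {i} {l} {j} C 0≤yl 0≤Y yi yj =
    pos*≡0⇒≡0 c₃>0 0≤yl (nonneg+≡0⇒≡0ˡ 0≤x 0≤z sum≡0) , pos*≡0⇒≡0 c₄>0 0≤Y (nonneg+≡0⇒≡0ʳ 0≤x 0≤z sum≡0)
    where
    open Circuit C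
    0≤x = *-nonneg (ℚ.<⇒≤ c₃>0) 0≤yl
    0≤z = *-nonneg (ℚ.<⇒≤ c₄>0) 0≤Y
    sum≡0 : c₃ ℚ.* slack l ℚ.+ c₄ ℚ.* (N ℚ.* b ℚ.- A) ≡ 0ℚ
    sum≡0 = trans (≡.sym relation) (cong₂ ℚ._+_ (trans (cong (c₁ ℚ.*_) yi) (ℚ.*-zeroʳ c₁)) (trans (cong (c₂ ℚ.*_) yj) (ℚ.*-zeroʳ c₂)))

  inner⇒outer : ∀ {i l j} → Circuit i l j → 0ℚ ℚ.≤ slack i → 0ℚ ℚ.≤ slack j →
    slack l ≡ 0ℚ → N ℚ.* b ℚ.- A ≡ 0ℚ → slack i ≡ 0ℚ × slack j ≡ 0ℚ
  inner⇒outer {i} {l} {j} C 0≤yi 0≤yj yl Y =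
    pos*≡0⇒≡0 c₁>0 0≤yi (nonneg+≡0⇒≡0ˡ 0≤x 0≤z sum≡0) , pos*≡0⇒≡0 c₂>0 0≤yj (nonneg+≡0⇒≡0ʳ 0≤x 0≤z sum≡0)
    where
    open Circuit C
    0≤x = *-nonneg (ℚ.<⇒≤ c₁>0) 0≤yi
    0≤z = *-nonneg (ℚ.<⇒≤ c₂>0) 0≤yj
    sum≡0 : c₁ ℚ.* slack i ℚ.+ c₂ ℚ.* slack j ≡ 0ℚ
    sum≡0 = trans relation (cong₂ ℚ._+_ (trans (cong (c₃ ℚ.*_) yl) (ℚ.*-zeroʳ c₃)) (trans (cong (c₄ ℚ.*_) Y) (ℚ.*-zeroʳ c₄)))

  nat-circuit : ∀ {i l j} → i < l → l < j → Circuit (toℚ (+ i)) (toℚ (+ l)) (toℚ (+ j))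
  nat-circuit {i} i<l l<j with ℕ.m≤n⇒∃[o]m+o≡n i<l | ℕ.m≤n⇒∃[o]m+o≡n l<j
  ... | p , refl | q , refl = subst₂ (Circuit (toℚ (+ i))) (step i p) (trans (cong (ℚ._+ (1ℚ ℚ.+ toℚ (+ q))) (step i p)) (step (suc i ℕ.+ p) q))
    (circuit (toℚ-nonneg i) (toℚ-nonneg p) (toℚ-nonneg q))
    where
    step : ∀ i p → toℚ (+ i) ℚ.+ (1ℚ ℚ.+ toℚ (+ p)) ≡ toℚ (+ (suc i ℕ.+ p))
    step i p = trans (cong (toℚ (+ i) ℚ.+_) (≡.sym (toℚ-+ (+ 1) (+ p))))
      (trans (≡.sym (toℚ-+ (+ i) (+ suc p))) (cong (toℚ ∘ +_) (ℕ.+-suc i p)))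

-- These are the combinatorial consequences of the Radon relations for a face. The classification
-- uses them alone, without the supporting hyperplane.
record Closed {n k} (A : Subset n) (B : Subset (suc k)) : Set where
  field
    outer⇒between : ∀ {i l j} → toℕ i < toℕ l → toℕ l < toℕ j →
      lookup B i ≡ true → lookup B j ≡ true → lookup B l ≡ true
    outer⇒units : ∀ {i j} → suc (toℕ i) < toℕ j →
      lookup B i ≡ true → lookup B j ≡ true → ∀ x → lookup A x ≡ true
    between⇒outer : ∀ {i l j} → toℕ i < toℕ l → toℕ l < toℕ j →
      lookup B l ≡ true → (∀ x → lookup A x ≡ true) → lookup B i ≡ true × lookup B j ≡ true

-- The total slack at the unit points is a sum of nonnegative terms, so it vanishes exactly when
-- every unit point lies on the face.
isFace⇒closed : ∀ {n k} {A : Subset n} {B : Subset (suc k)} → IsFace (vertices n k) (A ++ᵛ B) → Closed A B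
isFace⇒closed {n} {k} {A} {B} (a , b , below , zeros) = record
  { outer⇒between = λ {i} {l} {j} i<l l<j i∈ j∈ → B⁺ l (proj₁ (outer⇒inner N b Σa (a zero) 0≤N (C i<l l<j) (0≤y l) 0≤Y (B⁻ i i∈) (B⁻ j j∈)))
  ; outer⇒units = λ {i} {j} 1+i<j i∈ j∈ x →
      -- The parameter i + 1 lies strictly between i and j and serves as the middle point of the
      -- relation.
      let l = Fin.fromℕ< (ℕ.<-trans 1+i<j (Fin.toℕ<n j))
          l≡ = Fin.toℕ-fromℕ< (ℕ.<-trans 1+i<j (Fin.toℕ<n j))
      in A⁺ x (sum-nonneg-zero n 0≤z (trans Σz (proj₂ (outer⇒inner N b Σa (a zero) 0≤N
           (C {i} {l} {j} (subst (toℕ i <_) (≡.sym l≡) ℕ.≤-refl) (subst (_< toℕ j) (≡.sym l≡) 1+i<j))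
           (0≤y l) 0≤Y (B⁻ i i∈) (B⁻ j j∈)))) x)
  ; between⇒outer = λ {i} {l} {j} i<l l<j l∈ all →
      let yi , yj = inner⇒outer N b Σa (a zero) 0≤N (C i<l l<j) (0≤y i) (0≤y j) (B⁻ l l∈)
                      (trans (≡.sym Σz) (sum-zero n (λ x → A⁻ x (all x))))
      in B⁺ i yi , B⁺ j yj
  }
  where
  N = toℚ (+ n)
  0≤N = toℚ-nonneg n
  Σa = sumℚ n (λ x → a (suc x))
  y : ℚ → ℚ
  y = slack N b Σa (a zero) 0≤N
  ι : Fin (suc k) → ℚ
  ι s = toℚ (+ toℕ s)
  z : Fin n → ℚ
  z x = b ℚ.- a (suc x)
  C : ∀ {i l j : Fin (suc k)} → toℕ i < toℕ l → toℕ l < toℕ j → Circuit N b Σa (a zero) 0≤N (ι i) (ι l) (ι j)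
  C = nat-circuit N b Σa (a zero) 0≤N
  0≤y : ∀ s → 0ℚ ℚ.≤ y (ι s)
  0≤y s = minus-nonneg (subst (ℚ._≤ b) (eval-curve {n} {k} a s) (below (n ↑ʳ s)))
  0≤z : ∀ x → 0ℚ ℚ.≤ z x
  0≤z x = minus-nonneg (subst (ℚ._≤ b) (eval-unit {n} {k} a x) (below (x ↑ˡ suc k)))
  B⁻ : ∀ s → lookup B s ≡ true → y (ι s) ≡ 0ℚ
  B⁻ s s∈ = minus≡0 (trans (≡.sym (eval-curve {n} {k} a s)) (Equivalence.to (zeros (n ↑ʳ s)) (trans (Vec.lookup-++ʳ A B s) s∈)))
  B⁺ : ∀ s → y (ι s) ≡ 0ℚ → lookup B s ≡ true
  B⁺ s e = trans (≡.sym (Vec.lookup-++ʳ A B s)) (Equivalence.from (zeros (n ↑ʳ s)) (trans (eval-curve {n} {k} a s) (minus≡0⁻ e)))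
  A⁻ : ∀ x → lookup A x ≡ true → z x ≡ 0ℚ
  A⁻ x x∈ = minus≡0 (trans (≡.sym (eval-unit {n} {k} a x)) (Equivalence.to (zeros (x ↑ˡ suc k)) (trans (Vec.lookup-++ˡ A B x) x∈)))
  A⁺ : ∀ x → z x ≡ 0ℚ → lookup A x ≡ true
  A⁺ x e = trans (≡.sym (Vec.lookup-++ˡ A B x)) (Equivalence.from (zeros (x ↑ˡ suc k)) (trans (eval-unit {n} {k} a x) (minus≡0⁻ e)))
  Σz : sumℚ n z ≡ N ℚ.* b ℚ.- Σa
  Σz = trans (sum-minus n (λ _ → b) (λ x → a (suc x))) (cong (ℚ._- Σa) (sum-const n b))
  0≤Y : 0ℚ ℚ.≤ N ℚ.* b ℚ.- Σa
  0≤Y = subst (0ℚ ℚ.≤_) Σz (sum-nonneg n 0≤z)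

gapless⇒path : ∀ {m} (B : Subset m) →
  (∀ s t → lookup B s ≡ true → lookup B t ≡ true → ¬ suc (toℕ s) < toℕ t) → Path B
gapless⇒path []          gapless = none
gapless⇒path (false ∷ B) gapless with gapless⇒path B (λ s t s∈ t∈ lt → gapless (suc s) (suc t) s∈ t∈ (s≤s lt))
... | none  = none
... | one i = one (suc i)
... | two i = two (suc i)
gapless⇒path (true ∷ []) gapless = one zero
-- Since position 0 is occupied, every position from 2 on must be empty.
gapless⇒path (true ∷ b ∷ B) gapless with lookup-ext {u = B} {⊥} (λ s → trans (≢true⇒false (λ s∈ → gapless zero (suc (suc s)) refl s∈ (s≤s (s≤s z≤n)))) (≡.sym (lookup-⊥ s)))
gapless⇒path (true ∷ true ∷ B)  gapless | refl = two zero
gapless⇒path (true ∷ false ∷ B) gapless | refl = one zero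

full? : ∀ {n} (A : Subset n) → (∃ λ x → lookup A x ≡ false) ⊎ A ≡ ⊤
full? []          = inj₂ refl
full? (false ∷ A) = inj₁ (zero , refl)
full? (true ∷ A) with full? A
... | inj₁ (x , x∉) = inj₁ (suc x , x∉)
... | inj₂ refl     = inj₂ refl

-- When all unit points are present, an interior curve point forces every other one, each being
-- paired with the endpoint on the opposite side; then `B` would be full. So `B` lies in the two
-- endpoints, and it cannot contain both, as they would force an interior point or already exhaust
-- the curve.
closed⇒end : ∀ {n k} {B : Subset (suc (suc k))} → Closed {n} ⊤ B → B ≢ ⊤ → End B
closed⇒end {n} {k} {B} closed B≢⊤ = classify _ _ refl refl
  where
  open Closed closed
  1+k : Fin (suc (suc k))
  1+k = fromℕ (suc k)
  toℕ-1+k : toℕ 1+k ≡ suc k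
  toℕ-1+k = Fin.toℕ-fromℕ (suc k)
  full⇒⊤ : (∀ s → lookup B s ≡ true) → B ≡ ⊤
  full⇒⊤ full = lookup-ext (λ s → trans (full s) (≡.sym (lookup-⊤ s)))
  interior∉ : ∀ l → 0 < toℕ l → toℕ l < suc k → lookup B l ≢ true
  interior∉ l 0<l l<1+k l∈ = B≢⊤ (full⇒⊤ full)
    where
    l<last = subst (toℕ l <_) (≡.sym toℕ-1+k) l<1+k
    full : ∀ s → lookup B s ≡ true
    full s with ℕ.<-cmp (toℕ s) (toℕ l)
    ... | tri< s<l _ _ = proj₁ (between⇒outer {s} {l} {1+k} s<l l<last l∈ lookup-⊤)
    ... | tri≈ _ s≡l _ = subst (λ s → lookup B s ≡ true) (≡.sym (Fin.toℕ-injective s≡l)) l∈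
    ... | tri> _ _ l<s = proj₂ (between⇒outer {zero} {l} {s} 0<l l<s l∈ lookup-⊤)
  both∉ : lookup B zero ≡ true → lookup B 1+k ≢ true
  both∉ = by-length k refl
    where
    by-length : ∀ k′ → k ≡ k′ → lookup B zero ≡ true → lookup B 1+k ≢ true
    -- Here the curve has only its two endpoints and no interior point to force.
    by-length zero     refl 0∈ 1∈ = B≢⊤ (full⇒⊤ λ { zero → 0∈ ; (suc zero) → 1∈ })
    by-length (suc k′) refl 0∈ last∈ = interior∉ (suc zero) (s≤s z≤n) (s≤s (s≤s z≤n))
      (outer⇒between {zero} {suc zero} {1+k} (s≤s z≤n) (s≤s (s≤s z≤n)) 0∈ last∈)
  agree : ∀ B′ → lookup B zero ≡ lookup B′ zero → lookup B 1+k ≡ lookup B′ 1+k →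
    (∀ s → s ≢ zero → s ≢ 1+k → lookup B′ s ≡ false) → B ≡ B′
  agree B′ e₀ eₖ interior = lookup-ext same
    where
    same : ∀ s → lookup B s ≡ lookup B′ s
    same s with s Fin.≟ zero | s Fin.≟ 1+k
    ... | yes refl | _        = e₀
    ... | no _     | yes refl = eₖ
    ... | no s≢0   | no s≢k   = trans
      (≢true⇒false (interior∉ s (ℕ.n≢0⇒n>0 (s≢0 ∘ Fin.toℕ-injective))
        (ℕ.≤∧≢⇒< (Fin.toℕ≤pred[n] s) (λ e → s≢k (Fin.toℕ-injective (trans e (≡.sym toℕ-1+k)))))))
      (≡.sym (interior s s≢0 s≢k))
  classify : ∀ b₀ bₖ → lookup B zero ≡ b₀ → lookup B 1+k ≡ bₖ → End B
  classify true  true  e₀ eₖ = contradiction eₖ (both∉ e₀)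
  classify true  false e₀ eₖ = subst End (≡.sym (agree ⁅ zero ⁆ e₀ (trans eₖ (≡.sym (lookup-⊥ (fromℕ k))))
    (λ s s≢0 _ → ≢true⇒false (s≢0 ∘ ⁅⁆⁻ zero s)))) first
  classify false true  e₀ eₖ = subst End (≡.sym (agree ⁅ 1+k ⁆ e₀ (trans eₖ (≡.sym (⁅⁆⁺ 1+k)))
    (λ s _ s≢k → ≢true⇒false (s≢k ∘ ⁅⁆⁻ 1+k s)))) last
  classify false false e₀ eₖ = subst End (≡.sym (agree ⊥ e₀ (trans eₖ (≡.sym (lookup-⊥ 1+k)))
    (λ s _ _ → lookup-⊥ s))) none

⊤++⊤ : ∀ m {n} → ⊤ {m} ++ᵛ ⊤ {n} ≡ ⊤
⊤++⊤ zero    = refl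
⊤++⊤ (suc m) = cong (true ∷_) (⊤++⊤ m)

-- A missing unit point forbids gaps in `B`, which leaves the faces of the path. If none is missing,
-- properness of `S` gives B ≠ ⊤ and leaves the ends.
boundary⇒face : ∀ {n k} (S : Subset (n ℕ.+ suc (suc k))) → BoundaryFace (vertices n (suc k)) S → Face {n} {suc k} S
boundary⇒face {n} {k} S (isFace , S≢⊤) with Vec.splitAt n S
... | A , B , refl with isFace⇒closed {n} {suc k} {A} {B} isFace | full? A
...   | closed | inj₂ refl    = end (closed⇒end {n} closed λ { refl → S≢⊤ (⊤++⊤ n) })
...   | closed | inj₁ (x , x∉) = side x x∉ (gapless⇒path B λ s t s∈ t∈ gap →
  contradiction (trans (≡.sym (outer⇒units {s} {t} gap s∈ t∈ x)) x∉) λ ())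
  where open Closed closed

-- Counting faces

subsets : ∀ n → List (Subset n)
subsets zero    = [] ∷ᴸ []ᴸ
subsets (suc n) = map (true ∷_) (subsets n) ++ map (false ∷_) (subsets n)

properSubsets : ∀ n → List (Subset n)
properSubsets zero    = []ᴸ
properSubsets (suc n) = map (true ∷_) (properSubsets n) ++ map (false ∷_) (subsets n)

∈-subsets : ∀ {n} (A : Subset n) → A ∈ subsets n
∈-subsets []          = here refl
∈-subsets (true ∷ A)  = ∈.∈-++⁺ˡ (∈.∈-map⁺ (true ∷_) (∈-subsets A))
∈-subsets (false ∷ A) = ∈.∈-++⁺ʳ _ (∈.∈-map⁺ (false ∷_) (∈-subsets A))

∈-properSubsets⁺ : ∀ {n} (A : Subset n) x → lookup A x ≡ false → A ∈ properSubsets n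
∈-properSubsets⁺ (true ∷ A)  (suc x) x∉ = ∈.∈-++⁺ˡ (∈.∈-map⁺ (true ∷_) (∈-properSubsets⁺ A x x∉))
∈-properSubsets⁺ (false ∷ A) _       _  = ∈.∈-++⁺ʳ _ (∈.∈-map⁺ (false ∷_) (∈-subsets A))

all-proper : ∀ n → All (λ A → ∃ λ x → lookup A x ≡ false) (properSubsets n)
all-proper zero    = []
all-proper (suc n) = All.++⁺ (All.map⁺ (All.map (λ (x , x∉) → suc x , x∉) (all-proper n)))
  (All.map⁺ (All.tabulate λ _ → zero , refl))

heads-disjoint : ∀ {n} (As Bs : List (Subset n)) {S} → ¬ (S ∈ map (true ∷_) As × S ∈ map (false ∷_) Bs)
heads-disjoint _ _ (p , q) with ∈.∈-map⁻ (true ∷_) p | ∈.∈-map⁻ (false ∷_) q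
... | _ , _ , refl | _ , _ , ()

unique-subsets : ∀ n → Unique (subsets n)
unique-subsets zero    = [] ∷ []
unique-subsets (suc n) = Unique.++⁺ (Unique.map⁺ Vec.∷-injectiveʳ (unique-subsets n))
  (Unique.map⁺ Vec.∷-injectiveʳ (unique-subsets n)) (heads-disjoint _ _)

unique-properSubsets : ∀ n → Unique (properSubsets n)
unique-properSubsets zero    = []
unique-properSubsets (suc n) = Unique.++⁺ (Unique.map⁺ Vec.∷-injectiveʳ (unique-properSubsets n))
  (Unique.map⁺ Vec.∷-injectiveʳ (unique-subsets n)) (heads-disjoint _ _)

singles : ∀ k → List (Subset (suc k))
singles k = map ⁅_⁆ (allFin (suc k))

pairs : ∀ k → List (Subset (suc k))
pairs k = map pair (allFin k)

paths : ∀ k → List (Subset (suc k))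
paths k = ⊥ ∷ᴸ singles k ++ pairs k

ends : ∀ k → List (Subset (suc k))
ends k = ⊥ ∷ᴸ ⁅ zero ⁆ ∷ᴸ ⁅ fromℕ k ⁆ ∷ᴸ []ᴸ

faces : ∀ n k → List (Subset (n ℕ.+ suc k))
faces n k = cartesianProductWith _++ᵛ_ (properSubsets n) (paths k) ++ map (⊤ {n} ++ᵛ_) (ends k)

path⇒∈ : ∀ {k} {B : Subset (suc k)} → Path B → B ∈ paths k
path⇒∈ none    = here refl
path⇒∈ (one i) = there (∈.∈-++⁺ˡ (∈.∈-map⁺ ⁅_⁆ (∈.∈-allFin i)))
path⇒∈ (two i) = there (∈.∈-++⁺ʳ _ (∈.∈-map⁺ pair (∈.∈-allFin i)))

∈⇒path : ∀ {k} {B : Subset (suc k)} → B ∈ paths k → Path B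
∈⇒path (here refl) = none
∈⇒path {k} (there p) with ∈.∈-++⁻ (singles k) p
... | inj₁ q with ∈.∈-map⁻ ⁅_⁆ {xs = allFin (suc k)} q
...   | i , _ , refl = one i
∈⇒path {k} (there p) | inj₂ q with ∈.∈-map⁻ pair q
...   | i , _ , refl = two i

end⇒∈ : ∀ {k} {B : Subset (suc k)} → End B → B ∈ ends k
end⇒∈ none  = here refl
end⇒∈ first = there (here refl)
end⇒∈ last  = there (there (here refl))

∈⇒end : ∀ {k} {B : Subset (suc k)} → B ∈ ends k → End B
∈⇒end (here refl)                 = none
∈⇒end (there (here refl))         = first
∈⇒end (there (there (here refl))) = last

face⇒∈ : ∀ {n k} {S : Subset (n ℕ.+ suc k)} → Face {n} {k} S → S ∈ faces n k
face⇒∈ (side {A} x x∉ p) =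
  ∈.∈-++⁺ˡ (∈.∈-cartesianProductWith⁺ _++ᵛ_ (∈-properSubsets⁺ A x x∉) (path⇒∈ p))
face⇒∈ {n} (end e) = ∈.∈-++⁺ʳ _ (∈.∈-map⁺ (⊤ {n} ++ᵛ_) (end⇒∈ e))

∈⇒face : ∀ {n k} {S : Subset (n ℕ.+ suc k)} → S ∈ faces n k → Face {n} {k} S
∈⇒face {n} {k} p with ∈.∈-++⁻ (cartesianProductWith _++ᵛ_ (properSubsets n) (paths k)) p
... | inj₁ q with ∈.∈-cartesianProductWith⁻ _++ᵛ_ (properSubsets n) (paths k) q
...   | A , B , A∈ , B∈ , refl = let x , x∉ = All.lookup (all-proper n) A∈ in side x x∉ (∈⇒path B∈)
∈⇒face {n} {k} p | inj₂ q with ∈.∈-map⁻ (⊤ {n} ++ᵛ_) q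
...   | B , B∈ , refl = end (∈⇒end B∈)

size≢ : ∀ {m} {A B : Subset m} {a b} → ∣ A ∣ ≡ a → ∣ B ∣ ≡ b → a ≢ b → A ≢ B
size≢ p q a≢b refl = a≢b (trans (≡.sym p) q)

pair-injective : ∀ {m} {i j : Fin m} → pair i ≡ pair j → i ≡ j
pair-injective {i = zero}  {zero}  _ = refl
pair-injective {i = suc i} {suc j} e = cong suc (pair-injective (Vec.∷-injectiveʳ e))

unique-paths : ∀ k → Unique (paths k)
unique-paths k = All.++⁺ {xs = singles k}
    (All.map⁺ {xs = allFin (suc k)} {f = ⁅_⁆} (All.tabulate λ {i} _ → size≢ (Subset.∣⊥∣≡0 (suc k)) (Subset.∣⁅x⁆∣≡1 i) λ ()))
    (All.map⁺ {xs = allFin k} {f = pair} (All.tabulate λ {i} _ → size≢ (Subset.∣⊥∣≡0 (suc k)) (∣pair∣ i) λ ()))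
  ∷ Unique.++⁺ (Unique.map⁺ (λ {i} {j} e → ⁅⁆⁻ j i (trans (≡.sym (cong (λ B → lookup B i) e)) (⁅⁆⁺ i))) (Unique.allFin⁺ (suc k)))
      (Unique.map⁺ pair-injective (Unique.allFin⁺ k)) disjoint
  where
  disjoint : ∀ {B} → ¬ (B ∈ singles k × B ∈ pairs k)
  disjoint (p , q) with ∈.∈-map⁻ ⁅_⁆ {xs = allFin (suc k)} p | ∈.∈-map⁻ pair q
  ... | i , _ , refl | j , _ , e = size≢ (Subset.∣⁅x⁆∣≡1 i) (∣pair∣ j) (λ ()) e

-- The path has at least two points here; for a single point the first and the last would coincide.
unique-ends : ∀ k → Unique (ends (suc k))
unique-ends k = ((λ ()) ∷ size≢ (Subset.∣⊥∣≡0 (suc (suc k))) (Subset.∣⁅x⁆∣≡1 (fromℕ (suc k))) (λ ()) ∷ [])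
  ∷ ((λ ()) ∷ []) ∷ [] ∷ []

unique-faces : ∀ n k → Unique (faces n (suc k))
unique-faces n k = Unique.++⁺
  (Unique.cartesianProductWith⁺ _++ᵛ_ (λ {A} {A′} e → Vec.++-injective A A′ e) (unique-properSubsets n) (unique-paths (suc k)))
  (Unique.map⁺ (λ e → proj₂ (Vec.++-injective (⊤ {n}) ⊤ e)) (unique-ends k))
  disjoint
  where
  disjoint : ∀ {S} → ¬ (S ∈ cartesianProductWith _++ᵛ_ (properSubsets n) (paths (suc k)) × S ∈ map (⊤ {n} ++ᵛ_) (ends (suc k)))
  disjoint (p , q) with ∈.∈-cartesianProductWith⁻ _++ᵛ_ (properSubsets n) (paths (suc k)) p | ∈.∈-map⁻ (⊤ {n} ++ᵛ_) q
  ... | A , B , A∈ , B∈ , refl | B′ , _ , e with All.lookup (all-proper n) A∈ | Vec.++-injective A ⊤ e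
  ...   | x , x∉ | refl , _ = contradiction (trans (≡.sym x∉) (lookup-⊤ x)) λ ()

-- Weighted sums over the faces

sumBy : ∀ {A : Set} → (A → ℤ) → List A → ℤ
sumBy g []ᴸ       = + 0
sumBy g (x ∷ᴸ xs) = g x ℤ.+ sumBy g xs

sumBy-++ : ∀ {A : Set} (g : A → ℤ) xs ys → sumBy g (xs ++ ys) ≡ sumBy g xs ℤ.+ sumBy g ys
sumBy-++ g []ᴸ       ys = ≡.sym (ℤ.+-identityˡ _)
sumBy-++ g (x ∷ᴸ xs) ys = trans (cong (ℤ._+_ (g x)) (sumBy-++ g xs ys)) (≡.sym (ℤ.+-assoc (g x) _ _))

sumBy-map : ∀ {A B : Set} (g : B → ℤ) (f : A → B) xs → sumBy g (map f xs) ≡ sumBy (λ x → g (f x)) xs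
sumBy-map g f []ᴸ       = refl
sumBy-map g f (x ∷ᴸ xs) = cong (ℤ._+_ (g (f x))) (sumBy-map g f xs)

sumBy-cong : ∀ {A : Set} {g h : A → ℤ} {xs} → All (λ x → g x ≡ h x) xs → sumBy g xs ≡ sumBy h xs
sumBy-cong []       = refl
sumBy-cong (e ∷ es) = cong₂ ℤ._+_ e (sumBy-cong es)

sumBy-*ʳ : ∀ {A : Set} (g : A → ℤ) c xs → sumBy (λ x → g x ℤ.* c) xs ≡ sumBy g xs ℤ.* c
sumBy-*ʳ g c []ᴸ       = refl
sumBy-*ʳ g c (x ∷ᴸ xs) = trans (cong (ℤ._+_ (g x ℤ.* c)) (sumBy-*ʳ g c xs)) (≡.sym (ℤ.*-distribʳ-+ c (g x) (sumBy g xs)))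

sumBy-const : ∀ {A : Set} {g : A → ℤ} {c} xs → (∀ x → g x ≡ c) → sumBy g xs ≡ + length xs ℤ.* c
sumBy-const {c = c} []ᴸ       eq = refl
sumBy-const {c = c} (x ∷ᴸ xs) eq = trans (cong₂ ℤ._+_ (eq x) (sumBy-const xs eq)) (lemma c (+ length xs))
  where
  lemma : ∀ c l → c ℤ.+ l ℤ.* c ≡ (+ 1 ℤ.+ l) ℤ.* c
  lemma = solve-∀

sumBy-cartesian : ∀ {A B C : Set} (g : C → ℤ) (f : A → B → C) xs ys →
  sumBy g (cartesianProductWith f xs ys) ≡ sumBy (λ x → sumBy (λ y → g (f x y)) ys) xs
sumBy-cartesian g f []ᴸ       ys = refl
sumBy-cartesian g f (x ∷ᴸ xs) ys = trans (sumBy-++ g (map (f x) ys) (cartesianProductWith f xs ys))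
  (cong₂ ℤ._+_ (sumBy-map g (f x) ys) (sumBy-cartesian g f xs ys))

indicator : ℕ → ℕ → ℕ
indicator c i with c ℕ.≟ i
... | yes _ = 1
... | no _  = 0

indicator-≢ : ∀ {c i} → c ≢ i → indicator c i ≡ 0
indicator-≢ {c} {i} c≢i with c ℕ.≟ i
... | yes c≡i = contradiction c≡i c≢i
... | no _    = refl

indicator-refl : ∀ c → indicator c c ≡ 1
indicator-refl c with c ℕ.≟ c
... | yes _  = refl
... | no c≢c = contradiction refl c≢c

sum-indicator : ∀ d c (g : ℕ → ℤ) → c ≤ d → sumℤ≤ d (λ i → + indicator c i ℤ.* g i) ≡ g c
sum-indicator zero    zero g z≤n = ℤ.*-identityˡ (g 0)
sum-indicator (suc d) c    g c≤  = by (c ℕ.≟ suc d)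
  where
  by : Dec (c ≡ suc d) → sumℤ≤ (suc d) (λ i → + indicator c i ℤ.* g i) ≡ g c
  by (yes c≡) = trans (cong₂ ℤ._+_
      (sumℤ≤-zero d (λ i i≤d → cong (λ z → + z ℤ.* g i)
        (indicator-≢ {c} (λ c≡i → ℕ.<⇒≢ (s≤s i≤d) (trans (≡.sym c≡i) c≡)))))
      (trans (cong (λ z → + z ℤ.* g (suc d)) (trans (cong (indicator c) (≡.sym c≡)) (indicator-refl c)))
        (ℤ.*-identityˡ (g (suc d)))))
    (trans (ℤ.+-identityˡ (g (suc d))) (cong g (≡.sym c≡)))
  by (no c≢) = trans (cong₂ ℤ._+_ (sum-indicator d c g (ℕ.≤-pred (ℕ.≤∧≢⇒< c≤ c≢)))
      (cong (λ z → + z ℤ.* g (suc d)) (indicator-≢ c≢)))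
    (ℤ.+-identityʳ (g c))

length-filter : ∀ {A : Set} (size : A → ℕ) i x xs → length (filter (λ y → size y ℕ.≟ i) (x ∷ᴸ xs))
  ≡ indicator (size x) i ℕ.+ length (filter (λ y → size y ℕ.≟ i) xs)
length-filter size i x xs with size x ℕ.≟ i
... | yes p = cong length (List.filter-accept (λ y → size y ℕ.≟ i) p)
... | no ¬p = cong length (List.filter-reject (λ y → size y ℕ.≟ i) ¬p)

-- This replaces the face numbers by one weight per face, a form in which the join structure of the
-- face list can be used.
sum-by-size : ∀ {A : Set} d (size : A → ℕ) (g : ℕ → ℤ) {xs} → All (λ x → size x ≤ d) xs →
  sumℤ≤ d (λ i → + length (filter (λ x → size x ℕ.≟ i) xs) ℤ.* g i) ≡ sumBy (λ x → g (size x)) xs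
sum-by-size d size g []                  = sumℤ≤-zero d (λ _ _ → refl)
sum-by-size d size g {x ∷ᴸ xs} (x≤ ∷ xs≤) = trans
  (sumℤ≤-cong d (λ i _ → trans
    (cong (λ z → + z ℤ.* g i) (length-filter size i x xs))
    (ℤ.*-distribʳ-+ (g i) (+ indicator (size x) i) (+ length (filter (λ x → size x ℕ.≟ i) xs)))))
  (trans (sumℤ≤-+ d (λ i → + indicator (size x) i ℤ.* g i) _)
    (cong₂ ℤ._+_ (sum-indicator d (size x) g x≤) (sum-by-size d size g xs≤)))

geometric : ℤ → ℕ → ℤ
geometric x zero    = + 0
geometric x (suc n) = geometric x n ℤ.+ x ℤ.^ n

geometric-closed : ∀ x n → x ℤ.^ n ≡ + 1 ℤ.+ geometric x n ℤ.* (x ℤ.- + 1)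
geometric-closed x zero    = refl
geometric-closed x (suc n) = trans (cong (x ℤ.*_) (geometric-closed x n))
  (trans (lemma x (geometric x n)) (cong (λ z → + 1 ℤ.+ (geometric x n ℤ.+ z) ℤ.* (x ℤ.- + 1)) (≡.sym (geometric-closed x n))))
  where
  lemma : ∀ x g → x ℤ.* (+ 1 ℤ.+ g ℤ.* (x ℤ.- + 1)) ≡ + 1 ℤ.+ (g ℤ.+ (+ 1 ℤ.+ g ℤ.* (x ℤ.- + 1))) ℤ.* (x ℤ.- + 1)
  lemma = solve-∀

sum-powers : ∀ x n → sumℤ≤ n (λ i → x ℤ.^ (n ∸ i)) ≡ geometric x (suc n)
sum-powers x zero    = refl
sum-powers x (suc n) = trans (sumℤ≤-first n (λ i → x ℤ.^ (suc n ∸ i)))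
  (trans (cong (ℤ._+_ (x ℤ.^ suc n)) (sum-powers x n)) (ℤ.+-comm (x ℤ.^ suc n) (geometric x (suc n))))

size-complement : ∀ {n} (A : Subset n) → n ≡ ∣ A ∣ ℕ.+ ∣ ∁ A ∣
size-complement []          = refl
size-complement (true ∷ A)  = cong suc (size-complement A)
size-complement (false ∷ A) = trans (cong suc (size-complement A)) (≡.sym (ℕ.+-suc (∣ A ∣) (∣ ∁ A ∣)))

suc-size-complement : ∀ {n} (A : Subset n) → suc n ≡ ∣ A ∣ ℕ.+ suc ∣ ∁ A ∣
suc-size-complement A = trans (cong suc (size-complement A)) (≡.sym (ℕ.+-suc (∣ A ∣) (∣ ∁ A ∣)))

codim : ∀ {n k} (A : Subset n) (B : Subset k) → suc n ∸ ∣ A ++ᵛ B ∣ ≡ suc ∣ ∁ A ∣ ∸ ∣ B ∣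
codim A B = trans (cong₂ _∸_ (suc-size-complement A) (∣++∣ A B))
  (ℕ.[m+n]∸[m+o]≡n∸o (∣ A ∣) (suc (∣ ∁ A ∣)) (∣ B ∣))

path-size : ∀ {m} {B : Subset m} → Path B → ∣ B ∣ ≤ 2
path-size (none {m}) = ℕ.≤-trans (ℕ.≤-reflexive (Subset.∣⊥∣≡0 m)) z≤n
path-size (one i)    = ℕ.≤-trans (ℕ.≤-reflexive (Subset.∣⁅x⁆∣≡1 i)) (s≤s z≤n)
path-size (two i)    = ℕ.≤-reflexive (∣pair∣ i)

end-size : ∀ {k} {B : Subset (suc k)} → End B → ∣ B ∣ ≤ 1
end-size {k} none  = ℕ.≤-trans (ℕ.≤-reflexive (Subset.∣⊥∣≡0 (suc k))) z≤n
end-size {k} first = ℕ.≤-reflexive (Subset.∣⁅x⁆∣≡1 {suc k} zero)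
end-size {k} last  = ℕ.≤-reflexive (Subset.∣⁅x⁆∣≡1 (fromℕ k))

face-size : ∀ {n k S} → Face {n} {k} S → ∣ S ∣ ≤ suc n
face-size (side {A} {B} a a∉ p) = let e , e≡ = complement-nonempty A a a∉ in
  subst₂ _≤_ (≡.sym (∣++∣ A B)) (≡.sym (suc-size-complement A))
    (ℕ.+-monoʳ-≤ (∣ A ∣) (ℕ.≤-trans (path-size p) (s≤s (subst (1 ≤_) (≡.sym e≡) (s≤s z≤n)))))
face-size {n} (end {B} e) = subst₂ _≤_ (≡.sym (∣++∣ (⊤ {n}) B)) (≡.sym (suc-size-complement (⊤ {n})))
  (ℕ.+-monoʳ-≤ (∣ ⊤ {n} ∣) (ℕ.≤-trans (end-size e) (s≤s z≤n)))

module _ (x : ℤ) where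

  private
    y = x ℤ.- + 1

  -- The binomial theorem for x = 1 + y: each element contributes 1 if it is chosen and y if it is
  -- not.
  sum-subsets : ∀ n → sumBy (λ A → y ℤ.^ ∣ ∁ A ∣) (subsets n) ≡ x ℤ.^ n
  sum-subsets zero    = refl
  sum-subsets (suc n) = begin
    sumBy w (map (true ∷_) (subsets n) ++ map (false ∷_) (subsets n))
      ≡⟨ sumBy-++ w (map (true ∷_) (subsets n)) (map (false ∷_) (subsets n)) ⟩
    sumBy w (map (true ∷_) (subsets n)) ℤ.+ sumBy w (map (false ∷_) (subsets n))
      ≡⟨ cong₂ ℤ._+_ (sumBy-map w (true ∷_) (subsets n)) (sumBy-map w (false ∷_) (subsets n)) ⟩
    sumBy (λ A → y ℤ.^ ∣ ∁ A ∣) (subsets n) ℤ.+ sumBy (λ A → y ℤ.* y ℤ.^ ∣ ∁ A ∣) (subsets n)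
      ≡⟨ cong₂ ℤ._+_ (sum-subsets n) (trans (sumBy-cong {xs = subsets n} (All.tabulate λ {A} _ → ℤ.*-comm y (y ℤ.^ ∣ ∁ A ∣)))
           (trans (sumBy-*ʳ _ y (subsets n)) (cong (ℤ._* y) (sum-subsets n)))) ⟩
    x ℤ.^ n ℤ.+ x ℤ.^ n ℤ.* y
      ≡⟨ lemma x (x ℤ.^ n) ⟩
    x ℤ.^ suc n ∎
    where
    open ≡-Reasoning
    w : Subset (suc n) → ℤ
    w A = y ℤ.^ ∣ ∁ A ∣
    lemma : ∀ x p → p ℤ.+ p ℤ.* (x ℤ.- + 1) ≡ x ℤ.* p
    lemma = solve-∀

  -- Proper subsets have a nonempty complement, so one factor y can be removed from each weight.
  -- Those lacking the first element then contribute x^n, the next term of the geometric sum.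
  sum-properSubsets : ∀ n → sumBy (λ A → y ℤ.^ (∣ ∁ A ∣ ∸ 1)) (properSubsets n) ≡ geometric x n
  sum-properSubsets zero    = refl
  sum-properSubsets (suc n) =
    trans (sumBy-++ w (map (true ∷_) (properSubsets n)) (map (false ∷_) (subsets n)))
      (cong₂ ℤ._+_ (trans (sumBy-map w (true ∷_) (properSubsets n)) (sum-properSubsets n))
                   (trans (sumBy-map w (false ∷_) (subsets n)) (sum-subsets n)))
    where
    w : Subset (suc n) → ℤ
    w A = y ℤ.^ (∣ ∁ A ∣ ∸ 1)

  weight : ∀ {m} → ℕ → Subset m → ℤ
  weight d S = y ℤ.^ (d ∸ ∣ S ∣)

  -- The path has one empty face, k + 1 points and k edges. Relative to the power of y belonging to
  -- `A`, they weigh y², y and 1.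
  sum-paths : ∀ {n} k (A : Subset n) a → lookup A a ≡ false →
    sumBy (λ B → weight (suc n) (A ++ᵛ B)) (paths k) ≡ y ℤ.^ (∣ ∁ A ∣ ∸ 1) ℤ.* (y ℤ.* y ℤ.+ + suc k ℤ.* y ℤ.+ + k)
  sum-paths {n} k A a a∉ with complement-nonempty A a a∉
  ... | e , e≡ rewrite e≡ = begin
    g ⊥ ℤ.+ sumBy g (singles k ++ pairs k)
      ≡⟨ cong₂ ℤ._+_ (g≡ ⊥ (Subset.∣⊥∣≡0 (suc k))) (sumBy-++ g (singles k) (pairs k)) ⟩
    y ℤ.^ (2 ℕ.+ e) ℤ.+ (sumBy g (singles k) ℤ.+ sumBy g (pairs k))
      ≡⟨ cong (ℤ._+_ (y ℤ.^ (2 ℕ.+ e))) (cong₂ ℤ._+_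
           (trans (sumBy-map g ⁅_⁆ (allFin (suc k))) (trans (sumBy-const (allFin (suc k)) (λ i → g≡ ⁅ i ⁆ (Subset.∣⁅x⁆∣≡1 i)))
             (cong (λ l → + l ℤ.* y ℤ.^ (1 ℕ.+ e)) (List.length-tabulate {n = suc k} (λ i → i)))))
           (trans (sumBy-map g pair (allFin k)) (trans (sumBy-const (allFin k) (λ i → g≡ (pair i) (∣pair∣ i)))
             (cong (λ l → + l ℤ.* y ℤ.^ e) (List.length-tabulate {n = k} (λ i → i)))))) ⟩
    y ℤ.* (y ℤ.* y ℤ.^ e) ℤ.+ (+ suc k ℤ.* (y ℤ.* y ℤ.^ e) ℤ.+ + k ℤ.* y ℤ.^ e)
      ≡⟨ lemma y (y ℤ.^ e) (+ suc k) (+ k) ⟩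
    y ℤ.^ e ℤ.* (y ℤ.* y ℤ.+ + suc k ℤ.* y ℤ.+ + k) ∎
    where
    open ≡-Reasoning
    g : Subset (suc k) → ℤ
    g B = weight (suc n) (A ++ᵛ B)
    g≡ : ∀ B {b} → ∣ B ∣ ≡ b → g B ≡ y ℤ.^ (2 ℕ.+ e ∸ b)
    g≡ B refl = cong (y ℤ.^_) (trans (codim A B) (cong (λ c → suc c ∸ ∣ B ∣) e≡))
    lemma : ∀ y p a b → y ℤ.* (y ℤ.* p) ℤ.+ (a ℤ.* (y ℤ.* p) ℤ.+ b ℤ.* p) ≡ p ℤ.* (y ℤ.* y ℤ.+ a ℤ.* y ℤ.+ b)
    lemma = solve-∀

  sum-ends : ∀ n k → sumBy (λ B → weight (suc n) (⊤ {n} ++ᵛ B)) (ends k) ≡ y ℤ.+ + 2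
  sum-ends n k = trans
    (cong₂ ℤ._+_ (g≡ ⊥ (Subset.∣⊥∣≡0 (suc k)))
      (cong₂ (λ a b → a ℤ.+ (b ℤ.+ + 0)) (g≡ ⁅ zero ⁆ (Subset.∣⁅x⁆∣≡1 {suc k} zero)) (g≡ ⁅ fromℕ k ⁆ (Subset.∣⁅x⁆∣≡1 (fromℕ k)))))
    (cong (ℤ._+ + 2) (ℤ.*-identityʳ y))
    where
    ∣∁⊤∣≡0 : ∀ n → ∣ ∁ (⊤ {n}) ∣ ≡ 0
    ∣∁⊤∣≡0 zero    = refl
    ∣∁⊤∣≡0 (suc n) = ∣∁⊤∣≡0 n
    g≡ : ∀ B {b} → ∣ B ∣ ≡ b → weight (suc n) (⊤ {n} ++ᵛ B) ≡ y ℤ.^ (1 ∸ b)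
    g≡ B refl = cong (y ℤ.^_) (trans (codim (⊤ {n}) B) (cong (λ c → suc c ∸ ∣ B ∣) (∣∁⊤∣≡0 n)))

  sum-faces : ∀ n k → sumBy (weight (suc n)) (faces n k)
    ≡ geometric x n ℤ.* (y ℤ.* y ℤ.+ + suc k ℤ.* y ℤ.+ + k) ℤ.+ (y ℤ.+ + 2)
  sum-faces n k = trans (sumBy-++ (weight (suc n)) (cartesianProductWith _++ᵛ_ (properSubsets n) (paths k)) (map (⊤ {n} ++ᵛ_) (ends k)))
    (cong₂ ℤ._+_
      (trans (sumBy-cartesian (weight (suc n)) _++ᵛ_ (properSubsets n) (paths k))
        (trans (sumBy-cong (All.map (λ {A} (a , a∉) → sum-paths k A a a∉) (all-proper n)))
          (trans (sumBy-*ʳ (λ A → y ℤ.^ (∣ ∁ A ∣ ∸ 1)) c (properSubsets n)) (cong (ℤ._* c) (sum-properSubsets n)))))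
      (trans (sumBy-map (weight (suc n)) (⊤ {n} ++ᵛ_) (ends k)) (sum-ends n k)))
    where
    c = y ℤ.* y ℤ.+ + suc k ℤ.* y ℤ.+ + k

-- The h-vector

hvec-last : ∀ d h → hvec (suc d) h (suc d) ≡ + 1
hvec-last d h with suc d ℕ.≟ suc d
... | yes _  = refl
... | no d≢d = contradiction refl d≢d

hvec-middle : ∀ d h i → suc i < d → hvec d h (suc i) ≡ + h
hvec-middle d h i 1+i<d with suc i ℕ.≟ d
... | yes e = contradiction e (ℕ.<⇒≢ 1+i<d)
... | no _  = refl

sum-hvec : ∀ n k x → sumℤ≤ (suc (suc n)) (λ i → hvec (suc (suc n)) k i ℤ.* x ℤ.^ (suc (suc n) ∸ i))
  ≡ x ℤ.^ suc (suc n) ℤ.+ (+ k ℤ.* (x ℤ.* geometric x (suc n)) ℤ.+ + 1)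
sum-hvec n k x = trans (sumℤ≤-first (suc n) (λ i → hvec d k i ℤ.* x ℤ.^ (d ∸ i)))
  (cong₂ ℤ._+_ (ℤ.*-identityˡ (x ℤ.^ d)) (cong₂ ℤ._+_ middle last-term))
  where
  d = suc (suc n)
  last-term : hvec d k d ℤ.* x ℤ.^ (n ∸ n) ≡ + 1
  last-term = cong₂ ℤ._*_ (hvec-last (suc n) k) (cong (x ℤ.^_) (ℕ.n∸n≡0 n))
  middle : sumℤ≤ n (λ i → hvec d k (suc i) ℤ.* x ℤ.^ (suc n ∸ i)) ≡ + k ℤ.* (x ℤ.* geometric x (suc n))
  middle = trans (sumℤ≤-cong n (λ i i≤n → cong₂ ℤ._*_ (hvec-middle d k i (s≤s (s≤s i≤n))) (cong (x ℤ.^_) (ℕ.+-∸-assoc 1 i≤n))))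
    (trans (sumℤ≤-*ˡ n (+ k) (λ i → x ℤ.* x ℤ.^ (n ∸ i)))
      (cong (+ k ℤ.*_) (trans (sumℤ≤-*ˡ n x (λ i → x ℤ.^ (n ∸ i))) (cong (x ℤ.*_) (sum-powers x n)))))

hVector : ∀ n k → HVector (vertices (suc n) (suc k)) (hvec (suc (suc n)) (suc k))
hVector n k = (λ i → length (filter (λ S → ∣ S ∣ ℕ.≟ i) fs)) , count , identity
  where
  d = suc (suc n)
  h = suc k
  fs = faces (suc n) h
  count : ∀ i → i ≤ d → HasCount (λ S → BoundaryFace (vertices (suc n) h) S × ∣ S ∣ ≡ i) (length (filter (λ S → ∣ S ∣ ℕ.≟ i) fs))
  count i _ = filter (λ S → ∣ S ∣ ℕ.≟ i) fs , Unique.filter⁺ (λ S → ∣ S ∣ ℕ.≟ i) (unique-faces (suc n) k) , refl ,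
    λ S → mk⇔
      (λ (bd , size) → ∈.∈-filter⁺ (λ S → ∣ S ∣ ℕ.≟ i) (face⇒∈ (boundary⇒face {suc n} {k} S bd)) size)
      (λ S∈ → let S∈fs , size = ∈.∈-filter⁻ (λ S → ∣ S ∣ ℕ.≟ i) {xs = fs} S∈
                  face = ∈⇒face {suc n} {h} S∈fs
              in (face⇒isFace {suc n} {h} face , face⇒proper {suc n} {k} face) , size)
  size≤ : All (λ S → ∣ S ∣ ≤ d) fs
  size≤ = All.tabulate λ S∈ → face-size (∈⇒face {suc n} {h} S∈)
  identity : ∀ x → sumℤ≤ d (λ i → hvec d h i ℤ.* x ℤ.^ (d ∸ i))
                 ≡ sumℤ≤ d (λ i → + length (filter (λ S → ∣ S ∣ ℕ.≟ i) fs) ℤ.* (x ℤ.- + 1) ℤ.^ (d ∸ i))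
  identity x = begin
    sumℤ≤ d (λ i → hvec d h i ℤ.* x ℤ.^ (d ∸ i))
      ≡⟨ sum-hvec n h x ⟩
    x ℤ.* x ℤ.^ suc n ℤ.+ (+ h ℤ.* (x ℤ.* g) ℤ.+ + 1)
      ≡⟨ cong (λ p → x ℤ.* p ℤ.+ (+ h ℤ.* (x ℤ.* g) ℤ.+ + 1)) (geometric-closed x (suc n)) ⟩
    x ℤ.* (+ 1 ℤ.+ g ℤ.* (x ℤ.- + 1)) ℤ.+ (+ h ℤ.* (x ℤ.* g) ℤ.+ + 1)
      -- With y = x - 1 the quadratic factors as (y + 1)(y + h) = x(x - 1 + h), so both sides equal
      -- xg(x - 1) + hxg + x + 1.
      ≡⟨ lemma x g (+ h) ⟩
    g ℤ.* ((x ℤ.- + 1) ℤ.* (x ℤ.- + 1) ℤ.+ + suc h ℤ.* (x ℤ.- + 1) ℤ.+ + h) ℤ.+ (x ℤ.- + 1 ℤ.+ + 2)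
      ≡⟨ sum-faces x (suc n) h ⟨
    sumBy (weight x d) fs
      ≡⟨ sum-by-size d ∣_∣ (λ i → (x ℤ.- + 1) ℤ.^ (d ∸ i)) size≤ ⟨
    _ ∎
    where
    open ≡-Reasoning
    g = geometric x (suc n)
    lemma : ∀ x g h → x ℤ.* (+ 1 ℤ.+ g ℤ.* (x ℤ.- + 1)) ℤ.+ (h ℤ.* (x ℤ.* g) ℤ.+ + 1)
      ≡ g ℤ.* ((x ℤ.- + 1) ℤ.* (x ℤ.- + 1) ℤ.+ (+ 1 ℤ.+ h) ℤ.* (x ℤ.- + 1) ℤ.+ h) ℤ.+ (x ℤ.- + 1 ℤ.+ + 2)
    lemma = solve-∀

-- The characteristic function local to AllVertices has no name outside Defs either.
vertexIndicator : ∀ {d m} (V : Fin m → Point d) → Σ (Fin m → Fin m → Bool) λ χ →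
  AllVertices V ≡ (∀ j → IsFace V (tabulate (λ i → χ i j)))
vertexIndicator V = _ , refl

vertexIndicator-⁅⁆ : ∀ {d m} (V : Fin m → Point d) i j → lookup ⁅ j ⁆ i ≡ proj₁ (vertexIndicator V) i j
vertexIndicator-⁅⁆ V i j with i Fin.≟ j
... | yes refl = ⁅⁆⁺ i
... | no i≢j   = ≢true⇒false (i≢j ∘ ⁅⁆⁻ j i)

allVertices⁺ : ∀ {d m} (V : Fin m → Point d) → (∀ j → IsFace V ⁅ j ⁆) → AllVertices V
allVertices⁺ V isFace j = subst (IsFace V)
  (trans (≡.sym (Vec.tabulate∘lookup ⁅ j ⁆)) (Vec.tabulate-cong (λ i → vertexIndicator-⁅⁆ V i j))) (isFace j)

⁅↑ˡ⁆ : ∀ {n} m (x : Fin n) → ⁅ x ⁆ ++ᵛ ⊥ {m} ≡ ⁅ x ↑ˡ m ⁆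
⁅↑ˡ⁆ {suc n} m zero    = cong (true ∷_) (⊥++⊥ n)
  where
  ⊥++⊥ : ∀ n → ⊥ {n} ++ᵛ ⊥ {m} ≡ ⊥
  ⊥++⊥ zero    = refl
  ⊥++⊥ (suc n) = cong (false ∷_) (⊥++⊥ n)
⁅↑ˡ⁆ m (suc x) = cong (false ∷_) (⁅↑ˡ⁆ m x)

⁅↑ʳ⁆ : ∀ n {m} (s : Fin m) → ⊥ {n} ++ᵛ ⁅ s ⁆ ≡ ⁅ n ↑ʳ s ⁆
⁅↑ʳ⁆ zero    s = refl
⁅↑ʳ⁆ (suc n) s = cong (false ∷_) (⁅↑ʳ⁆ n s)

vertex-face : ∀ n k j → Face {suc n} {k} ⁅ j ⁆
vertex-face n k = vertex-cases {suc n} {suc k}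
  (λ x → subst (Face {suc n} {k}) (⁅↑ˡ⁆ (suc k) x) (unit x (full? ⁅ x ⁆)))
  (λ s → subst (Face {suc n} {k}) (⁅↑ʳ⁆ (suc n) s) (side {A = ⊥} zero refl (one s)))
  where
  unit : ∀ x → (∃ λ a → lookup ⁅ x ⁆ a ≡ false) ⊎ ⁅ x ⁆ ≡ ⊤ → Face {suc n} {k} (⁅ x ⁆ ++ᵛ ⊥)
  unit x (inj₁ (a , a∉)) = side {A = ⁅ x ⁆} a a∉ none
  -- This case occurs for d = 2, where the only unit point already makes up the whole simplex on the
  -- unit points.
  unit x (inj₂ eq)       = subst (λ A → Face {suc n} {k} (A ++ᵛ ⊥)) (≡.sym eq) (end none)

theorem2p4 : (d : ℕ) → 2 ≤ d → (h1 : ℕ) → 1 ≤ h1 →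
    Σ ℕ λ m → Σ (Fin m → Point d) λ V →
    AllVertices V × FullDim V × Simplicial V ×
    (∀ F → Facet V F → NormVol V F (d ∸ 1) (+ 1)) ×
    HVector V (hvec d h1)
theorem2p4 (suc (suc n)) (s≤s (s≤s z≤n)) (suc k) (s≤s z≤n) =
  suc n ℕ.+ suc (suc k) , V ,
  allVertices⁺ V (λ j → face⇒isFace {suc n} {suc k} (vertex-face n (suc k) j)) ,
  fullDim (suc n) k ,
  (λ S bd → unimodular⇒affIndep {V = V} {S} (unimodular S bd)) ,
  (λ { S (bd , size) → unimodular⇒normVol {V = V} {S} (unimodular S bd) size }) ,
  hVector n k
  where
  V = vertices (suc n) (suc k)
  unimodular : ∀ S → BoundaryFace V S → Unimodular V S
  unimodular S bd = face⇒unimodular {suc n} {suc k} (boundary⇒face {suc n} {k} S bd)
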